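{- There exist a constant $c_0\in(0,1)$ and a 1-sided error, nonadaptive, $t$-online-erasure-resilient $\varepsilon$-tester for linearity of functions $f:\{0,1\}^d\to\{0,1\}$ that is correct whenever $t\le c_0\cdot\varepsilon\cdot 2^{d/4}$ and makes $O(t/\varepsilon)$ queries.
   Context: Online-erasure model. An input is a function $f:D\to R$ on a finite domain $D$. An algorithm accesses $f$ only through an oracle $\mathcal{O}$ by querying points $x\in D$ one at a time and receiving $\mathcal{O}(x)$. Initially $\mathcal{O}(x)=f(x)$ for all $x\in D$. For $t\in\mathbb{N}$, a $t$-online-erasure oracle, after answering each query, may choose up to $t$ points $x\in D$ and set $\mathcal{O}(x)=\perp$ (a special "erased" symbol); these values are used to answer all future queries. The choice of erasures (the adversarial strategy) may depend on $f$, on the queries and answers so far, and on the algorithm's code, but not on the algorithm's future random coins; the algorithm does not know where erasures are. A property $\mathcal{P}$ is a set of functions; $f$ is $\varepsilon$-far from $\mathcal{P}$ if for every $g\in\mathcal{P}$, $f$ and $g$ differ on at least an $\varepsilon$ fraction of $D$. A $t$-online-erasure-resilient $\varepsilon$-tester for $\mathcal{P}$ is a randomized algorithm that, given $t,\varepsilon$ and access to $f$ via a $t$-online-erasure oracle, for every adversarial strategy accepts with probability at least $2/3$ if $f\in\mathcal{P}$ and rejects with probability at least $2/3$ if $f$ is $\varepsilon$-far from $\mathcal{P}$. It has 1-sided error if it accepts every $f\in\mathcal{P}$ with probability 1; it is nonadaptive if its queries do not depend on answers to previous queries. A function $f:\{0,1\}^d\to\{0,1\}$ is linear if there is $S\subseteq[d]$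 with $f(x)=\sum_{i\in S}x[i]\bmod 2$ for all $x$. -}

module Defs where

open import Algebra.Definitions.RawSemiring using () renaming (_^_ to pow)
open import Data.Bool using (Bool; true; false; if_then_else_; _≟_)
open import Data.Fin using (Fin)
open import Data.Fin.Subset using (Subset)
open import Data.Fin.Subset.Properties using (_∈?_)
open import Data.Integer using (+_)
open import Data.List using (List; []; _∷_; _++_; map; length; filter; allFin)
import Data.List.Membership.DecPropositional as DecMembership
open import Data.Maybe using (Maybe; just; nothing)
open import Data.Nat using (ℕ; zero; suc; _^_; _⊔_; _%_; NonZero)
open import Data.Nat.ListAction using (sum)
open import Data.Nat.Properties using (m^n≢0)
open import Data.Product using (Σ-syntax; ∃-syntax; _×_; _,_)
open import Data.Rational using (ℚ; _/_; _≤_; _*_; 1ℚ; +-*-rawSemiring)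
open import Data.Vec using (Vec; lookup)
import Data.Vec as Vec
open import Data.Vec.Bounded using (Vec≤; toList)
open import Data.Vec.Properties using (≡-dec)
open import Relation.Binary.PropositionalEquality using (_≡_)
open import Relation.Nullary.Decidable using (does; ¬?)

fromℕ : ℕ → ℚ
fromℕ n = + n / 1

infixr 8 _^ℚ_
_^ℚ_ : ℚ → ℕ → ℚ
_^ℚ_ = pow +-*-rawSemiring

-- t ≤ a · 2^(d/4) for a ≥ 0. Since 2^(d/4) is in general irrational, both
-- (nonnegative) sides are raised to the fourth power.
_≤_·2^[_/4] : ℕ → ℚ → ℕ → Set
t ≤ a ·2^[ d /4] = fromℕ t ^ℚ 4 ≤ a ^ℚ 4 * fromℕ (2 ^ d)

Point : ℕ → Set
Point d = Vec Bool d

Input : ℕ → Set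
Input d = Point d → Bool

Property : ℕ → Set₁
Property d = Input d → Set

points : (d : ℕ) → List (Point d)
points zero    = Vec.[] ∷ []
points (suc d) = map (false Vec.∷_) (points d) ++ map (true Vec.∷_) (points d)

distance : ∀ {d} → Input d → Input d → ℚ
distance {d} f g =
  _/_ (+ length (filter (λ x → ¬? (f x ≟ g x)) (points d))) (2 ^ d) {{m^n≢0 2 d}}

_-farFrom_ : ∀ {d} → ℚ → Property d → Input d → Set
(ε -farFrom P) f = ∀ g → P g → ε ≤ distance f g

bit : Bool → ℕ
bit b = if b then 1 else 0

Linear : ∀ {d} → Property d
Linear {d} f = Σ[ S ∈ Subset d ] ∀ x →
  bit (f x) ≡ sum (map (λ i → bit (lookup x i)) (filter (_∈? S) (allFin d))) % 2

-- `nothing` is the erasure symbol ⊥.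
Answer : Set
Answer = Maybe Bool

Oracle : ℕ → Set
Oracle d = Point d → Answer

-- A deterministic, possibly adaptive algorithm; output `true` means accept.
data Algorithm (d : ℕ) : Set where
  output : Bool → Algorithm d
  query  : Point d → (Answer → Algorithm d) → Algorithm d

numQueries : ∀ {d} → Algorithm d → ℕ
numQueries (output _)  = 0
numQueries (query _ k) =
  suc (numQueries (k nothing) ⊔ (numQueries (k (just false)) ⊔ numQueries (k (just true))))

-- On every sequence of answers, the algorithm queries exactly the given
-- points, in the given order.
data HasQueries {d : ℕ} : List (Point d) → Algorithm d → Set where
  done : ∀ {b} → HasQueries [] (output b)
  ask  : ∀ {x xs k} → (∀ a → HasQueries xs (k a)) → HasQueries (x ∷ xs) (query x k)

-- All coins are summarised by one uniformly random seed.
record RandomizedAlgorithm (d : ℕ) : Set where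
  field
    seeds       : ℕ
    {{seeds≢0}} : NonZero seeds
    run         : Fin seeds → Algorithm d

open RandomizedAlgorithm public

Nonadaptive : ∀ {d} → RandomizedAlgorithm d → Set
Nonadaptive A = ∀ r → ∃[ xs ] HasQueries xs (run A r)

-- Queries with the answers received, most recent first.
History : ℕ → Set
History d = List (Point d × Answer)

-- The points to erase after each answer. Strategies are quantified after the
-- algorithm, so they may depend on its code; of its seed they see only what
-- the queries made so far reveal.
Strategy : (d t : ℕ) → Set
Strategy d t = Input d → History d → Vec≤ (Point d) t

erase : ∀ {d} → List (Point d) → Oracle d → Oracle d
erase xs O x = if does (x ∈ₗ? xs) then nothing else O x
  where open DecMembership (≡-dec _≟_) renaming (_∈?_ to _∈ₗ?_)

execute : ∀ {d t} → Strategy d t → Input d → Oracle d → History d → Algorithm d → Bool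
execute S f O h (output b)  = b
execute S f O h (query x k) = execute S f (erase (toList (S f h′)) O) h′ (k (O x))
  where h′ = (x , O x) ∷ h

outcome : ∀ {d t} → Strategy d t → Input d → Algorithm d → Bool
outcome S f = execute S f (λ x → just (f x)) []

Pr[_on_against_outputs_] : ∀ {d t} → RandomizedAlgorithm d → Input d → Strategy d t → Bool → ℚ
Pr[ A on f against S outputs b ] =
  + length (filter (λ r → outcome S f (run A r) ≟ b) (allFin (seeds A))) / seeds A

OneSidedError : ∀ {d} → ℕ → Property d → RandomizedAlgorithm d → Set
OneSidedError {d} t P A = (S : Strategy d t) (f : Input d) →
  P f → Pr[ A on f against S outputs true ] ≡ 1ℚ

OnlineErasureResilientTester : ∀ {d} → ℕ → ℚ → Property d → RandomizedAlgorithm d → Set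
OnlineErasureResilientTester {d} t ε P A = (S : Strategy d t) (f : Input d) →
    (P f → + 2 / 3 ≤ Pr[ A on f against S outputs true ])
  × ((ε -farFrom P) f → + 2 / 3 ≤ Pr[ A on f against S outputs false ])

{-# OPTIONS --safe #-}

-- The tester queries 2m uniformly random points x₁, …, xₘ, y₁, …, yₘ and then
-- the sums xᵢ + yⱼ for k random pairs (i , j), where k = O(1/ε) and m = O(t/ε).
-- It rejects if it sees a violation of f(x) + f(y) = f(x + y).
--
-- An ε-far function is violated by an ε fraction of the pairs (x , y), by the
-- Fourier-analytic proof for the Blum–Luby–Rubinfeld test. The reserve offers
-- m² sums, while the adversary makes only O(t m) erasures before the last query,
-- so a random sum is erased with probability O(t/m) = O(ε), unless sums collide,
-- which happens with probability at most m⁴/2ᵈ = O((t/ε)⁴/2ᵈ). Hence probably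
-- none of the k = O(1/ε) queried sums is erased, and by Chebyshev's inequality
-- probably some queried pair is violated.
module Submission where

open import Defs
open import Data.Bool using (Bool; true; false; not; _∧_; _∨_; _xor_)
import Data.Bool as Bool
open import Data.Bool.Properties using (xor-comm)
open import Data.Bool.Solver using (module xor-∧-Solver)
open import Data.Empty using (⊥-elim)
open import Data.Fin using (Fin; zero; suc)
import Data.Fin as Fin
open import Data.Fin.Subset using (Subset)
open import Data.Fin.Subset.Properties using (_∈?_)
open import Data.Integer using (ℤ; +_; -[1+_]; 0ℤ; 1ℤ; -1ℤ; +≤+; +<+; Positive; positive; nonNegative) renaming (_+_ to _+ᶻ_; _*_ to _*ᶻ_; _-_ to _-ᶻ_; -_ to -ᶻ_; _≤_ to _≤ᶻ_)
import Data.Integer.Properties as ℤ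
open import Data.Integer.Tactic.RingSolver using () renaming (solve-∀ to solve-∀ᶻ)
open import Data.List using (List; []; _∷_; _++_; map; length; filter; allFin; cartesianProduct)
import Data.List as List
import Data.List.Membership.DecPropositional as DecMembership
open import Data.List.Properties using (length-++; length-tabulate; map-tabulate; tabulate-lookup)
open import Data.Maybe using (just; nothing)
open import Data.Nat using (ℕ; zero; suc; _+_; _*_; _^_; _%_; _⊔_; _≤_; z≤n; s≤s; NonZero; >-nonZero; >-nonZero⁻¹) renaming (_/_ to _/ⁿ_)
open import Data.Nat.DivMod using (%-distribˡ-+; m/n*n≤m; m≡m%n+[m/n]*n; m%n<n; m≥n⇒m/n>0)
open import Data.Nat.ListAction using (sum)
open import Data.Nat.Properties
open import Data.Nat.Tactic.RingSolver using (solve-∀)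
open import Data.Product using (Σ-syntax; ∃-syntax; _×_; _,_; proj₁; proj₂)
open import Data.Rational using (ℚ; mkℚ; 0ℚ; 1ℚ; _/_; *<*; *≤*) renaming (_*_ to _*ℚ_; _≤_ to _≤ℚ_; _<_ to _<ℚ_)
import Data.Rational.Properties as ℚ
open import Data.Rational.Unnormalised using (mkℚᵘ) renaming (*≤* to *≤*ᵘ; *≡* to *≡*ᵘ)
import Data.Rational.Unnormalised.Properties as ℚᵘ
open import Data.Sum using (inj₁; inj₂)
open import Data.Vec using (Vec; []; _∷_; lookup; zipWith; _[_]≔_)
import Data.Vec as Vec
open import Data.Vec.Bounded using (Vec≤; toList; isBounded)
open import Data.Vec.Properties using (≡-dec; ∷-injective; zipWith-comm; lookup∘update; lookup∘update′; lookup-map; length-toList; map-id)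
open import Function using (_∘_; id; it)
open import Relation.Binary.PropositionalEquality
open import Relation.Nullary using (Dec; yes; no; does; ¬?)
open import Relation.Unary using (Decidable)

-- Querying x, y and then x + y is hopeless: once x and y are known, the adversary erases x + y
-- before it is asked. This forces the sums to be drawn from a large reserve.
--
-- The adversary also reacts to the answers, and a query answered by an erasure changes the rest of
-- the run. Conditioning on this is avoided by an idealised run in which every answer is the true
-- value. Its erasures are determined by the queries alone, and it agrees with the real run until
-- the first erased query. Hence acceptance is bounded, for each outcome of the coins, by the number
-- of erased queries in the idealised run plus the indicator that no violated pair was drawn, and
-- expectations become plain sums.
--
-- Finally, the m² pairs of reserve points are not independent, because they share rows and columns.
-- Pairs of pairs with a common index make up at most a 2/m fraction, so they add little to the
-- variance.
--
-- Probabilities appear as counts in the natural numbers: denominators are multiplied out, and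
-- subtractions are moved to the other side.

private
  variable
    A B : Set
    d t m n k : ℕ

-- Finite sums over lists

∑ : List A → (A → ℕ) → ℕ
∑ []      f = 0
∑ (a ∷ L) f = f a + ∑ L f

infixr 5 ∑
syntax ∑ L (λ a → e) = ∑[ a ∈ L ] e

∑-cong : ∀ (L : List A) {f g} → (∀ a → f a ≡ g a) → ∑ L f ≡ ∑ L g
∑-cong []      f≗g = refl
∑-cong (a ∷ L) f≗g = cong₂ _+_ (f≗g a) (∑-cong L f≗g)

∑-mono-≤ : ∀ (L : List A) {f g} → (∀ a → f a ≤ g a) → ∑ L f ≤ ∑ L g
∑-mono-≤ []      f≤g = z≤n
∑-mono-≤ (a ∷ L) f≤g = +-mono-≤ (f≤g a) (∑-mono-≤ L f≤g)

∑-++ : ∀ (L M : List A) f → ∑ (L ++ M) f ≡ ∑ L f + ∑ M f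
∑-++ []      M f = refl
∑-++ (a ∷ L) M f = trans (cong (_+_ (f a)) (∑-++ L M f)) (sym (+-assoc (f a) _ _))

∑-map : ∀ (h : A → B) L f → ∑ (map h L) f ≡ ∑ L (f ∘ h)
∑-map h []      f = refl
∑-map h (a ∷ L) f = cong (_+_ (f (h a))) (∑-map h L f)

∑-distrib-+ : ∀ (L : List A) f g → ∑[ a ∈ L ] (f a + g a) ≡ ∑ L f + ∑ L g
∑-distrib-+ []      f g = refl
∑-distrib-+ (a ∷ L) f g rewrite ∑-distrib-+ L f g = lemma (f a) (g a) (∑ L f) (∑ L g)
  where
  lemma : ∀ p q r s → p + q + (r + s) ≡ p + r + (q + s)
  lemma = solve-∀

∑-*ˡ : ∀ (L : List A) c f → c * ∑ L f ≡ ∑[ a ∈ L ] c * f a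
∑-*ˡ []      c f = *-zeroʳ c
∑-*ˡ (a ∷ L) c f = trans (*-distribˡ-+ c (f a) _) (cong (_+_ (c * f a)) (∑-*ˡ L c f))

∑-*ʳ : ∀ (L : List A) f c → ∑ L f * c ≡ ∑[ a ∈ L ] f a * c
∑-*ʳ L f c = trans (*-comm _ c) (trans (∑-*ˡ L c f) (∑-cong L λ a → *-comm c (f a)))

∑-const : ∀ (L : List A) c → ∑[ _ ∈ L ] c ≡ length L * c
∑-const []      c = refl
∑-const (_ ∷ L) c = cong (_+_ c) (∑-const L c)

∑-zero : ∀ (L : List A) → ∑[ _ ∈ L ] 0 ≡ 0
∑-zero L = trans (∑-const L 0) (*-zeroʳ (length L))

∑-swap : ∀ (L : List A) (M : List B) (f : A → B → ℕ) →
         ∑[ a ∈ L ] ∑[ b ∈ M ] f a b ≡ ∑[ b ∈ M ] ∑[ a ∈ L ] f a b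
∑-swap []      M f = sym (∑-zero M)
∑-swap (a ∷ L) M f =
  trans (cong (_+_ (∑ M (f a))) (∑-swap L M f)) (sym (∑-distrib-+ M (f a) _))

∑-product : ∀ (L : List A) (M : List B) f →
            ∑ (cartesianProduct L M) f ≡ ∑[ a ∈ L ] ∑[ b ∈ M ] f (a , b)
∑-product []      M f = refl
∑-product (a ∷ L) M f = trans (∑-++ (map (a ,_) M) _ f)
  (cong₂ _+_ (∑-map (a ,_) M f) (∑-product L M f))

∑-* : ∀ (L : List A) (M : List B) (f : A → ℕ) (g : B → ℕ) →
      ∑ L f * ∑ M g ≡ ∑[ a ∈ L ] ∑[ b ∈ M ] f a * g b
∑-* L M f g = trans (∑-*ʳ L f (∑ M g)) (∑-cong L λ a → ∑-*ˡ M (f a) g)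

length≡∑1 : ∀ (L : List A) → length L ≡ ∑[ _ ∈ L ] 1
length≡∑1 L = sym (trans (∑-const L 1) (*-identityʳ _))

length-filter≡∑ : ∀ {P : A → Set} (P? : Decidable P) L →
                  length (filter P? L) ≡ ∑[ a ∈ L ] bit (does (P? a))
length-filter≡∑ P? []      = refl
length-filter≡∑ P? (a ∷ L) with does (P? a)
... | true  = cong suc (length-filter≡∑ P? L)
... | false = length-filter≡∑ P? L

bit≤1 : ∀ b → bit b ≤ 1
bit≤1 true  = ≤-refl
bit≤1 false = z≤n

-- Independent uniform draws

vecs : List A → (n : ℕ) → List (Vec A n)
vecs L zero    = [] ∷ []
vecs L (suc n) = map (λ (a , v) → a ∷ v) (cartesianProduct L (vecs L n))

∑-vecs : ∀ (L : List A) n f → ∑ (vecs L (suc n)) f ≡ ∑[ a ∈ L ] ∑[ v ∈ vecs L n ] f (a ∷ v)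
∑-vecs L n f = trans (∑-map _ (cartesianProduct L (vecs L n)) f) (∑-product L (vecs L n) _)

length-vecs : ∀ (L : List A) n → length (vecs L n) ≡ length L ^ n
length-vecs L zero    = refl
length-vecs L (suc n) = begin
  length (vecs L (suc n))              ≡⟨ length≡∑1 (vecs L (suc n)) ⟩
  ∑[ _ ∈ vecs L (suc n) ] 1            ≡⟨ ∑-vecs L n _ ⟩
  ∑[ a ∈ L ] ∑[ v ∈ vecs L n ] 1       ≡⟨ ∑-const L _ ⟩
  length L * (∑[ v ∈ vecs L n ] 1)     ≡⟨ cong (length L *_) (sym (length≡∑1 (vecs L n))) ⟩
  length L * length (vecs L n)         ≡⟨ cong (length L *_) (length-vecs L n) ⟩
  length L * length L ^ n              ∎
  where open ≡-Reasoning

-- Redrawing one coordinate of a uniform vector leaves it uniform. All uses of independence among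
-- the reserve points go through this identity.
∑-resample : ∀ (L : List A) {n} (i : Fin n) f →
             length L * ∑ (vecs L n) f ≡ ∑[ v ∈ vecs L n ] ∑[ a ∈ L ] f (v [ i ]≔ a)
∑-resample L {suc n} zero f = begin
  length L * ∑ (vecs L (suc n)) f                      ≡⟨ cong (length L *_) (∑-vecs L n f) ⟩
  length L * (∑[ a ∈ L ] ∑[ v ∈ vecs L n ] f (a ∷ v))  ≡⟨ cong (length L *_) (∑-swap L (vecs L n) _) ⟩
  length L * (∑[ v ∈ vecs L n ] ∑[ a ∈ L ] f (a ∷ v))  ≡⟨ sym (∑-const L _) ⟩
  ∑[ b ∈ L ] ∑[ v ∈ vecs L n ] ∑[ a ∈ L ] f (a ∷ v)    ≡⟨ sym (∑-vecs L n _) ⟩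
  ∑[ v ∈ vecs L (suc n) ] ∑[ a ∈ L ] f (v [ zero ]≔ a) ∎
  where open ≡-Reasoning
∑-resample L {suc n} (suc i) f = begin
  length L * ∑ (vecs L (suc n)) f                             ≡⟨ cong (length L *_) (∑-vecs L n f) ⟩
  length L * (∑[ b ∈ L ] ∑[ v ∈ vecs L n ] f (b ∷ v))         ≡⟨ ∑-*ˡ L (length L) _ ⟩
  ∑[ b ∈ L ] length L * (∑[ v ∈ vecs L n ] f (b ∷ v))         ≡⟨ ∑-cong L (λ b → ∑-resample L i (f ∘ (b ∷_))) ⟩
  ∑[ b ∈ L ] ∑[ v ∈ vecs L n ] ∑[ a ∈ L ] f (b ∷ v [ i ]≔ a)  ≡⟨ sym (∑-vecs L n _) ⟩
  ∑[ v ∈ vecs L (suc n) ] ∑[ a ∈ L ] f (v [ suc i ]≔ a)       ∎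
  where open ≡-Reasoning

∑-allFin : ∀ n f → ∑ (allFin (suc n)) f ≡ f zero + ∑ (allFin n) (f ∘ suc)
∑-allFin n f = cong (_+_ (f zero)) (trans (cong (λ L → ∑ L f) (sym (map-tabulate (λ i → i) suc))) (∑-map suc (allFin n) f))

∑-allFin-≟ : ∀ {n} (i : Fin n) → ∑[ j ∈ allFin n ] bit (does (i Fin.≟ j)) ≡ 1
∑-allFin-≟ {suc n} zero    =
  trans (∑-allFin n (λ j → bit (does (zero Fin.≟ j)))) (cong suc (∑-zero (allFin n)))
∑-allFin-≟ {suc n} (suc i) =
  trans (∑-allFin n (λ j → bit (does (suc i Fin.≟ j)))) (∑-allFin-≟ i)

-- The Boolean cube

infix 4 _≟ₚ_
_≟ₚ_ : ∀ {d} (x y : Point d) → Dec (x ≡ y)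
_≟ₚ_ = ≡-dec Bool._≟_

infixl 6 _⊕_
_⊕_ : ∀ {d} → Point d → Point d → Point d
_⊕_ = zipWith _xor_

⊕-cancel : ∀ {d} (x y z : Point d) → x ⊕ y ≡ z → x ≡ z ⊕ y
⊕-cancel []      []      []      refl = refl
⊕-cancel (a ∷ x) (b ∷ y) (c ∷ z) eq with ∷-injective eq
... | refl , eq′ = cong₂ _∷_ (lemma a b) (⊕-cancel x y z eq′)
  where
  lemma : ∀ a b → a ≡ (a xor b) xor b
  lemma false false = refl
  lemma false true  = refl
  lemma true  false = refl
  lemma true  true  = refl

⊕-comm : ∀ {d} (x y : Point d) → x ⊕ y ≡ y ⊕ x
⊕-comm = zipWith-comm xor-comm

∑-points : ∀ d f → ∑ (points (suc d)) f ≡ ∑ (points d) (f ∘ (false ∷_)) + ∑ (points d) (f ∘ (true ∷_))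
∑-points d f = trans (∑-++ (map (false ∷_) (points d)) _ f)
  (cong₂ _+_ (∑-map (false ∷_) (points d) f) (∑-map (true ∷_) (points d) f))

length-points : ∀ d → length (points d) ≡ 2 ^ d
length-points zero    = refl
length-points (suc d) = begin
  length (points (suc d))               ≡⟨ length≡∑1 (points (suc d)) ⟩
  ∑[ _ ∈ points (suc d) ] 1             ≡⟨ ∑-points d _ ⟩
  ∑ (points d) (λ _ → 1) + ∑ (points d) (λ _ → 1) ≡⟨ cong (λ n → n + n) (sym (length≡∑1 (points d))) ⟩
  length (points d) + length (points d) ≡⟨ cong (λ n → n + n) (length-points d) ⟩
  2 ^ d + 2 ^ d                         ≡⟨ cong (_+_ (2 ^ d)) (sym (+-identityʳ (2 ^ d))) ⟩
  2 ^ suc d                             ∎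
  where open ≡-Reasoning

∑-points-≟ : ∀ {d} (z : Point d) → ∑[ x ∈ points d ] bit (does (x ≟ₚ z)) ≡ 1
∑-points-≟ []      = refl
∑-points-≟ {suc d} (false ∷ z) = trans (∑-points d _)
  (cong₂ _+_ (∑-points-≟ z) (∑-zero (points d)))
∑-points-≟ {suc d} (true ∷ z) = trans (∑-points d _)
  (cong₂ _+_ (∑-zero (points d)) (∑-points-≟ z))

-- Fourier analysis and the Blum–Luby–Rubinfeld test

dot : Vec Bool d → Point d → Bool
dot []      []      = false
dot (s ∷ S) (b ∷ x) = (s ∧ b) xor dot S x

violation : Input d → Point d → Point d → Bool
violation f x y = f x xor (f y xor f (x ⊕ y))

sign : Bool → ℤ
sign false = 1ℤ
sign true  = -1ℤ

∑ℤ : (Point d → ℤ) → ℤ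
∑ℤ {zero}  g = g []
∑ℤ {suc d} g = ∑ℤ (g ∘ (false ∷_)) +ᶻ ∑ℤ (g ∘ (true ∷_))

∑ℤ-cong : {g h : Point d → ℤ} → (∀ x → g x ≡ h x) → ∑ℤ g ≡ ∑ℤ h
∑ℤ-cong {zero}  g≗h = g≗h []
∑ℤ-cong {suc d} g≗h = cong₂ _+ᶻ_ (∑ℤ-cong (g≗h ∘ (false ∷_))) (∑ℤ-cong (g≗h ∘ (true ∷_)))

∑ℤ-mono-≤ : {g h : Point d → ℤ} → (∀ x → g x ≤ᶻ h x) → ∑ℤ g ≤ᶻ ∑ℤ h
∑ℤ-mono-≤ {zero}  g≤h = g≤h []
∑ℤ-mono-≤ {suc d} g≤h = ℤ.+-mono-≤ (∑ℤ-mono-≤ (g≤h ∘ (false ∷_))) (∑ℤ-mono-≤ (g≤h ∘ (true ∷_)))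

∑ℤ-distrib-+ : (g h : Point d → ℤ) → ∑ℤ (λ x → g x +ᶻ h x) ≡ ∑ℤ g +ᶻ ∑ℤ h
∑ℤ-distrib-+ {zero}  g h = refl
∑ℤ-distrib-+ {suc d} g h = trans
  (cong₂ _+ᶻ_ (∑ℤ-distrib-+ (g ∘ (false ∷_)) (h ∘ (false ∷_)))
             (∑ℤ-distrib-+ (g ∘ (true ∷_)) (h ∘ (true ∷_))))
  (lemma (∑ℤ (g ∘ (false ∷_))) (∑ℤ (h ∘ (false ∷_))) (∑ℤ (g ∘ (true ∷_))) (∑ℤ (h ∘ (true ∷_))))
  where
  lemma : ∀ p q r s → p +ᶻ q +ᶻ (r +ᶻ s) ≡ p +ᶻ r +ᶻ (q +ᶻ s)
  lemma = solve-∀ᶻ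

∑ℤ-*ˡ : ∀ c (g : Point d → ℤ) → ∑ℤ (λ x → c *ᶻ g x) ≡ c *ᶻ ∑ℤ g
∑ℤ-*ˡ {zero}  c g = refl
∑ℤ-*ˡ {suc d} c g = trans
  (cong₂ _+ᶻ_ (∑ℤ-*ˡ c (g ∘ (false ∷_))) (∑ℤ-*ˡ c (g ∘ (true ∷_))))
  (sym (ℤ.*-distribˡ-+ c _ _))

∑ℤ-neg : (g : Point d → ℤ) → ∑ℤ (λ x → -ᶻ g x) ≡ -ᶻ ∑ℤ g
∑ℤ-neg g = trans (∑ℤ-cong (λ x → sym (ℤ.-1*i≡-i (g x)))) (trans (∑ℤ-*ˡ -1ℤ g) (ℤ.-1*i≡-i _))

∑≡∑ℤ : (g : Point d → ℕ) → + ∑ (points d) g ≡ ∑ℤ (λ x → + g x)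
∑≡∑ℤ {zero}  g = cong +_ (+-identityʳ (g []))
∑≡∑ℤ {suc d} g = trans (cong +_ (∑-points d g))
  (cong₂ _+ᶻ_ (∑≡∑ℤ (g ∘ (false ∷_))) (∑≡∑ℤ (g ∘ (true ∷_))))

pow2ℤ : ∀ d → + (2 ^ suc d) ≡ + 2 *ᶻ + (2 ^ d)
pow2ℤ d = ℤ.pos-* 2 (2 ^ d)

-- The unnormalised Fourier coefficient Σₓ (−1)^⟨S,x⟩ g(x); see fourier-∑.
fourier : (Point d → ℤ) → Vec Bool d → ℤ
fourier g []          = g []
fourier g (false ∷ S) = fourier (g ∘ (false ∷_)) S +ᶻ fourier (g ∘ (true ∷_)) S
fourier g (true  ∷ S) = fourier (g ∘ (false ∷_)) S -ᶻ fourier (g ∘ (true ∷_)) S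

sign-not : ∀ b → sign (not b) ≡ -ᶻ sign b
sign-not false = refl
sign-not true  = refl

fourier-∑ : (g : Point d → ℤ) (S : Vec Bool d) → fourier g S ≡ ∑ℤ (λ x → sign (dot S x) *ᶻ g x)
fourier-∑ g []          = sym (ℤ.*-identityˡ (g []))
fourier-∑ g (false ∷ S) = cong₂ _+ᶻ_ (fourier-∑ (g ∘ (false ∷_)) S) (fourier-∑ (g ∘ (true ∷_)) S)
fourier-∑ g (true  ∷ S) = cong₂ _+ᶻ_ (fourier-∑ (g ∘ (false ∷_)) S) (begin
  -ᶻ fourier (g ∘ (true ∷_)) S                            ≡⟨ cong -ᶻ_ (fourier-∑ (g ∘ (true ∷_)) S) ⟩
  -ᶻ ∑ℤ (λ x → sign (dot S x) *ᶻ g (true ∷ x))             ≡⟨ ∑ℤ-neg (λ x → sign (dot S x) *ᶻ g (true ∷ x)) ⟨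
  ∑ℤ (λ x → -ᶻ (sign (dot S x) *ᶻ g (true ∷ x)))           ≡⟨ ∑ℤ-cong (λ x → trans (ℤ.neg-distribˡ-* (sign (dot S x)) _)
                                                              (cong (_*ᶻ g (true ∷ x)) (sym (sign-not (dot S x))))) ⟩
  ∑ℤ (λ x → sign (not (dot S x)) *ᶻ g (true ∷ x))         ∎)
  where open ≡-Reasoning

-- Induction on the dimension: splitting on the first coordinate turns the coefficients into sums
-- and differences of those of the two halves, and the parallelogram law adds up their squares.
parseval : (g : Point d → ℤ) → ∑ℤ (λ S → fourier g S *ᶻ fourier g S) ≡ + (2 ^ d) *ᶻ ∑ℤ (λ x → g x *ᶻ g x)
parseval {zero}  g = sym (ℤ.*-identityˡ _)
parseval {suc d} g = begin
  ∑ℤ (λ S → (g₀ S +ᶻ g₁ S) *ᶻ (g₀ S +ᶻ g₁ S)) +ᶻ ∑ℤ (λ S → (g₀ S -ᶻ g₁ S) *ᶻ (g₀ S -ᶻ g₁ S))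
    ≡⟨ ∑ℤ-distrib-+ (λ S → (g₀ S +ᶻ g₁ S) *ᶻ (g₀ S +ᶻ g₁ S)) (λ S → (g₀ S -ᶻ g₁ S) *ᶻ (g₀ S -ᶻ g₁ S)) ⟨
  ∑ℤ (λ S → (g₀ S +ᶻ g₁ S) *ᶻ (g₀ S +ᶻ g₁ S) +ᶻ (g₀ S -ᶻ g₁ S) *ᶻ (g₀ S -ᶻ g₁ S))
    ≡⟨ ∑ℤ-cong (λ S → lemma (g₀ S) (g₁ S)) ⟩
  ∑ℤ (λ S → + 2 *ᶻ (g₀ S *ᶻ g₀ S +ᶻ g₁ S *ᶻ g₁ S))
    ≡⟨ ∑ℤ-*ˡ (+ 2) (λ S → g₀ S *ᶻ g₀ S +ᶻ g₁ S *ᶻ g₁ S) ⟩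
  + 2 *ᶻ ∑ℤ (λ S → g₀ S *ᶻ g₀ S +ᶻ g₁ S *ᶻ g₁ S)
    ≡⟨ cong (+ 2 *ᶻ_) (∑ℤ-distrib-+ (λ S → g₀ S *ᶻ g₀ S) (λ S → g₁ S *ᶻ g₁ S)) ⟩
  + 2 *ᶻ (∑ℤ (λ S → g₀ S *ᶻ g₀ S) +ᶻ ∑ℤ (λ S → g₁ S *ᶻ g₁ S))
    ≡⟨ cong (+ 2 *ᶻ_) (cong₂ _+ᶻ_ (parseval (g ∘ (false ∷_))) (parseval (g ∘ (true ∷_)))) ⟩
  + 2 *ᶻ (+ (2 ^ d) *ᶻ q₀ +ᶻ + (2 ^ d) *ᶻ q₁)
    ≡⟨ lemma′ (+ (2 ^ d)) q₀ q₁ ⟩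
  + 2 *ᶻ + (2 ^ d) *ᶻ (q₀ +ᶻ q₁)
    ≡⟨ cong (_*ᶻ (q₀ +ᶻ q₁)) (pow2ℤ d) ⟨
  + (2 ^ suc d) *ᶻ (q₀ +ᶻ q₁) ∎
  where
  open ≡-Reasoning
  g₀ = fourier (g ∘ (false ∷_))
  g₁ = fourier (g ∘ (true ∷_))
  q₀ = ∑ℤ (λ x → g (false ∷ x) *ᶻ g (false ∷ x))
  q₁ = ∑ℤ (λ x → g (true ∷ x) *ᶻ g (true ∷ x))
  lemma : ∀ p q → (p +ᶻ q) *ᶻ (p +ᶻ q) +ᶻ (p -ᶻ q) *ᶻ (p -ᶻ q) ≡ + 2 *ᶻ (p *ᶻ p +ᶻ q *ᶻ q)
  lemma = solve-∀ᶻ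
  lemma′ : ∀ n p q → + 2 *ᶻ (n *ᶻ p +ᶻ n *ᶻ q) ≡ + 2 *ᶻ n *ᶻ (p +ᶻ q)
  lemma′ = solve-∀ᶻ

-- Three functions instead of one, because the induction on the dimension restricts them to
-- different halves of the cube.
triple : (g h k : Point d → ℤ) → ℤ
triple g h k = ∑ℤ (λ x → ∑ℤ (λ y → g x *ᶻ (h y *ᶻ k (x ⊕ y))))

triple-suc : (g h k : Point (suc d) → ℤ) → triple g h k ≡
  triple (g ∘ (false ∷_)) (h ∘ (false ∷_)) (k ∘ (false ∷_)) +ᶻ
  triple (g ∘ (false ∷_)) (h ∘ (true ∷_)) (k ∘ (true ∷_)) +ᶻ
  (triple (g ∘ (true ∷_)) (h ∘ (false ∷_)) (k ∘ (true ∷_)) +ᶻ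
   triple (g ∘ (true ∷_)) (h ∘ (true ∷_)) (k ∘ (false ∷_)))
triple-suc g h k = cong₂ _+ᶻ_
  (∑ℤ-distrib-+ (λ x → ∑ℤ (λ y → g (false ∷ x) *ᶻ (h (false ∷ y) *ᶻ k (false ∷ x ⊕ y))))
                (λ x → ∑ℤ (λ y → g (false ∷ x) *ᶻ (h (true ∷ y) *ᶻ k (true ∷ x ⊕ y)))))
  (∑ℤ-distrib-+ (λ x → ∑ℤ (λ y → g (true ∷ x) *ᶻ (h (false ∷ y) *ᶻ k (true ∷ x ⊕ y))))
                (λ x → ∑ℤ (λ y → g (true ∷ x) *ᶻ (h (true ∷ y) *ᶻ k (false ∷ x ⊕ y)))))

-- The convolution theorem at the point zero. Adding the products for the two values of the head of
-- `S` cancels every term with an odd number of factors among `g₁`, `h₁`, `k₁` and doubles the other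
-- four, which are the combinations of head bits that x, y and `x ⊕ y` can have.
fourier-triple : (g h k : Point d → ℤ) →
  ∑ℤ (λ S → fourier g S *ᶻ (fourier h S *ᶻ fourier k S)) ≡ + (2 ^ d) *ᶻ triple g h k
fourier-triple {zero}  g h k = sym (ℤ.*-identityˡ _)
fourier-triple {suc d} g h k = begin
  ∑ℤ s⁺ +ᶻ ∑ℤ s⁻
    ≡⟨ ∑ℤ-distrib-+ s⁺ s⁻ ⟨
  ∑ℤ (λ S → s⁺ S +ᶻ s⁻ S)
    ≡⟨ ∑ℤ-cong (λ S → lemma (g₀ S) (g₁ S) (h₀ S) (h₁ S) (k₀ S) (k₁ S)) ⟩
  ∑ℤ (λ S → + 2 *ᶻ (s₁ S +ᶻ s₂ S +ᶻ (s₃ S +ᶻ s₄ S)))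
    ≡⟨ ∑ℤ-*ˡ (+ 2) (λ S → s₁ S +ᶻ s₂ S +ᶻ (s₃ S +ᶻ s₄ S)) ⟩
  + 2 *ᶻ ∑ℤ (λ S → s₁ S +ᶻ s₂ S +ᶻ (s₃ S +ᶻ s₄ S))
    ≡⟨ cong (+ 2 *ᶻ_) (trans (∑ℤ-distrib-+ (λ S → s₁ S +ᶻ s₂ S) (λ S → s₃ S +ᶻ s₄ S))
                            (cong₂ _+ᶻ_ (∑ℤ-distrib-+ s₁ s₂) (∑ℤ-distrib-+ s₃ s₄))) ⟩
  + 2 *ᶻ (∑ℤ s₁ +ᶻ ∑ℤ s₂ +ᶻ (∑ℤ s₃ +ᶻ ∑ℤ s₄))
    ≡⟨ cong (+ 2 *ᶻ_) (cong₂ _+ᶻ_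
         (cong₂ _+ᶻ_ (fourier-triple (g ∘ (false ∷_)) (h ∘ (false ∷_)) (k ∘ (false ∷_)))
                    (fourier-triple (g ∘ (false ∷_)) (h ∘ (true ∷_)) (k ∘ (true ∷_))))
         (cong₂ _+ᶻ_ (fourier-triple (g ∘ (true ∷_)) (h ∘ (false ∷_)) (k ∘ (true ∷_)))
                    (fourier-triple (g ∘ (true ∷_)) (h ∘ (true ∷_)) (k ∘ (false ∷_))))) ⟩
  + 2 *ᶻ (N *ᶻ T₁ +ᶻ N *ᶻ T₂ +ᶻ (N *ᶻ T₃ +ᶻ N *ᶻ T₄))
    ≡⟨ lemma′ N T₁ T₂ T₃ T₄ ⟩
  + 2 *ᶻ N *ᶻ (T₁ +ᶻ T₂ +ᶻ (T₃ +ᶻ T₄))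
    ≡⟨ cong₂ _*ᶻ_ (pow2ℤ d) (triple-suc g h k) ⟨
  + (2 ^ suc d) *ᶻ triple g h k ∎
  where
  open ≡-Reasoning
  N  = + (2 ^ d)
  g₀ = fourier (g ∘ (false ∷_))
  g₁ = fourier (g ∘ (true ∷_))
  h₀ = fourier (h ∘ (false ∷_))
  h₁ = fourier (h ∘ (true ∷_))
  k₀ = fourier (k ∘ (false ∷_))
  k₁ = fourier (k ∘ (true ∷_))
  T₁ = triple (g ∘ (false ∷_)) (h ∘ (false ∷_)) (k ∘ (false ∷_))
  T₂ = triple (g ∘ (false ∷_)) (h ∘ (true ∷_)) (k ∘ (true ∷_))
  T₃ = triple (g ∘ (true ∷_)) (h ∘ (false ∷_)) (k ∘ (true ∷_))
  T₄ = triple (g ∘ (true ∷_)) (h ∘ (true ∷_)) (k ∘ (false ∷_))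
  s⁺ s⁻ s₁ s₂ s₃ s₄ : Vec Bool d → ℤ
  s⁺ S = (g₀ S +ᶻ g₁ S) *ᶻ ((h₀ S +ᶻ h₁ S) *ᶻ (k₀ S +ᶻ k₁ S))
  s⁻ S = (g₀ S -ᶻ g₁ S) *ᶻ ((h₀ S -ᶻ h₁ S) *ᶻ (k₀ S -ᶻ k₁ S))
  s₁ S = g₀ S *ᶻ (h₀ S *ᶻ k₀ S)
  s₂ S = g₀ S *ᶻ (h₁ S *ᶻ k₁ S)
  s₃ S = g₁ S *ᶻ (h₀ S *ᶻ k₁ S)
  s₄ S = g₁ S *ᶻ (h₁ S *ᶻ k₀ S)
  lemma : ∀ p q r s t u →
    (p +ᶻ q) *ᶻ ((r +ᶻ s) *ᶻ (t +ᶻ u)) +ᶻ (p -ᶻ q) *ᶻ ((r -ᶻ s) *ᶻ (t -ᶻ u)) ≡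
    + 2 *ᶻ (p *ᶻ (r *ᶻ t) +ᶻ p *ᶻ (s *ᶻ u) +ᶻ (q *ᶻ (r *ᶻ u) +ᶻ q *ᶻ (s *ᶻ t)))
  lemma = solve-∀ᶻ
  lemma′ : ∀ n p q r s → + 2 *ᶻ (n *ᶻ p +ᶻ n *ᶻ q +ᶻ (n *ᶻ r +ᶻ n *ᶻ s)) ≡ + 2 *ᶻ n *ᶻ (p +ᶻ q +ᶻ (r +ᶻ s))
  lemma′ = solve-∀ᶻ

sign-* : ∀ a b → sign a *ᶻ sign b ≡ sign (a xor b)
sign-* false false = refl
sign-* false true  = refl
sign-* true  false = refl
sign-* true  true  = refl

sign≡1-2bit : ∀ b → sign b ≡ 1ℤ +ᶻ -[1+ 1 ] *ᶻ + bit b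
sign≡1-2bit false = refl
sign≡1-2bit true  = refl

∑ℤ-1 : ∀ d → ∑ℤ {d} (λ _ → 1ℤ) ≡ + (2 ^ d)
∑ℤ-1 d = trans (sym (∑≡∑ℤ {d} (λ _ → 1))) (cong +_ (trans (sym (length≡∑1 (points d))) (length-points d)))

∑ℤ-sign : (g : Point d → Bool) → ∑ℤ (λ x → sign (g x)) ≡ + (2 ^ d) +ᶻ -[1+ 1 ] *ᶻ + ∑ (points d) (bit ∘ g)
∑ℤ-sign {d} g = begin
  ∑ℤ (λ x → sign (g x))                              ≡⟨ ∑ℤ-cong (λ x → sign≡1-2bit (g x)) ⟩
  ∑ℤ (λ x → 1ℤ +ᶻ -[1+ 1 ] *ᶻ + bit (g x))             ≡⟨ ∑ℤ-distrib-+ (λ _ → 1ℤ) (λ x → -[1+ 1 ] *ᶻ + bit (g x)) ⟩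
  ∑ℤ {d} (λ _ → 1ℤ) +ᶻ ∑ℤ (λ x → -[1+ 1 ] *ᶻ + bit (g x)) ≡⟨ cong₂ _+ᶻ_ (∑ℤ-1 d) (∑ℤ-*ˡ -[1+ 1 ] (λ x → + bit (g x))) ⟩
  + (2 ^ d) +ᶻ -[1+ 1 ] *ᶻ ∑ℤ (λ x → + bit (g x))      ≡⟨ cong (λ s → + (2 ^ d) +ᶻ -[1+ 1 ] *ᶻ s) (∑≡∑ℤ (bit ∘ g)) ⟨
  + (2 ^ d) +ᶻ -[1+ 1 ] *ᶻ + ∑ (points d) (bit ∘ g)    ∎
  where open ≡-Reasoning

square-nonNeg : ∀ i → 0ℤ ≤ᶻ i *ᶻ i
square-nonNeg (+ n)    = subst (0ℤ ≤ᶻ_) (ℤ.pos-* n n) (+≤+ z≤n)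
square-nonNeg -[1+ n ] = +≤+ z≤n

fourier-sign : (f : Input d) (S : Vec Bool d) →
  fourier (sign ∘ f) S ≡ + (2 ^ d) +ᶻ -[1+ 1 ] *ᶻ + (∑[ x ∈ points d ] bit (dot S x xor f x))
fourier-sign f S = begin
  fourier (sign ∘ f) S                        ≡⟨ fourier-∑ (sign ∘ f) S ⟩
  ∑ℤ (λ x → sign (dot S x) *ᶻ sign (f x))     ≡⟨ ∑ℤ-cong (λ x → sign-* (dot S x) (f x)) ⟩
  ∑ℤ (λ x → sign (dot S x xor f x))           ≡⟨ ∑ℤ-sign (λ x → dot S x xor f x) ⟩
  _                                           ∎
  where open ≡-Reasoning

triple-sign : (f : Input d) → triple (sign ∘ f) (sign ∘ f) (sign ∘ f) ≡
  + (2 ^ d) *ᶻ + (2 ^ d) +ᶻ -[1+ 1 ] *ᶻ + (∑[ x ∈ points d ] ∑[ y ∈ points d ] bit (violation f x y))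
triple-sign {d} f = begin
  ∑ℤ (λ x → ∑ℤ (λ y → sign (f x) *ᶻ (sign (f y) *ᶻ sign (f (x ⊕ y)))))
    ≡⟨ ∑ℤ-cong (λ x → ∑ℤ-cong (λ y → trans (cong (sign (f x) *ᶻ_) (sign-* (f y) _)) (sign-* (f x) _))) ⟩
  ∑ℤ (λ x → ∑ℤ (λ y → sign (violation f x y)))
    ≡⟨ ∑ℤ-cong (λ x → ∑ℤ-sign (violation f x)) ⟩
  ∑ℤ (λ x → N +ᶻ -[1+ 1 ] *ᶻ + v x)
    ≡⟨ ∑ℤ-distrib-+ (λ _ → N) (λ x → -[1+ 1 ] *ᶻ + v x) ⟩
  ∑ℤ {d} (λ _ → N) +ᶻ ∑ℤ (λ x → -[1+ 1 ] *ᶻ + v x)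
    ≡⟨ cong₂ _+ᶻ_ (∑ℤ-cong {d} (λ _ → sym (ℤ.*-identityʳ N))) (∑ℤ-*ˡ -[1+ 1 ] (+_ ∘ v)) ⟩
  ∑ℤ {d} (λ _ → N *ᶻ 1ℤ) +ᶻ -[1+ 1 ] *ᶻ ∑ℤ (+_ ∘ v)
    ≡⟨ cong₂ _+ᶻ_ (trans (∑ℤ-*ˡ {d} N (λ _ → 1ℤ)) (cong (N *ᶻ_) (∑ℤ-1 d)))
                  (cong (-[1+ 1 ] *ᶻ_) (sym (∑≡∑ℤ v))) ⟩
  N *ᶻ N +ᶻ -[1+ 1 ] *ᶻ + ∑ (points d) v ∎
  where
  open ≡-Reasoning
  N = + (2 ^ d)
  v : Point d → ℕ
  v x = ∑[ y ∈ points d ] bit (violation f x y)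

∑-sign² : (f : Input d) → ∑ℤ (λ x → sign (f x) *ᶻ sign (f x)) ≡ + (2 ^ d)
∑-sign² {d} f = trans (∑ℤ-cong (λ x → lemma (f x))) (∑ℤ-1 d)
  where
  lemma : ∀ b → sign b *ᶻ sign b ≡ 1ℤ
  lemma false = refl
  lemma true  = refl

-- Σ_S f̂(S)³ ≤ max f̂ · Σ_S f̂(S)², where the cubes count violations and the
-- maximum is small because f is far from every character.
blr-soundness : ∀ (f : Input d) a b →
  (∀ S → a * 2 ^ d ≤ b * (∑[ x ∈ points d ] bit (dot S x xor f x))) →
  a * (2 ^ d * 2 ^ d) ≤ b * (∑[ x ∈ points d ] ∑[ y ∈ points d ] bit (violation f x y))
blr-soundness {d} f a b far = ℤ.drop‿+≤+ (subst₂ _≤ᶻ_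
  (trans (cong (+ a *ᶻ_) (sym (ℤ.pos-* (2 ^ d) (2 ^ d)))) (sym (ℤ.pos-* a _)))
  (sym (ℤ.pos-* b V)) 2-cancelled)
  where
  open ℤ.≤-Reasoning
  N = + (2 ^ d)
  V = ∑[ x ∈ points d ] ∑[ y ∈ points d ] bit (violation f x y)
  T = triple (sign ∘ f) (sign ∘ f) (sign ∘ f)
  F = fourier (sign ∘ f)
  -- With ε = a/b, the number c/b is (1 - 2ε)N, the largest value that a Fourier coefficient of an
  -- ε-far function can take.
  c = (+ b -ᶻ + 2 *ᶻ + a) *ᶻ N

  instance
    N-positive : Positive N
    N-positive = positive (+<+ (m^n>0 2 d))

  F-bound : ∀ S → + b *ᶻ F S ≤ᶻ c
  F-bound S = begin
    + b *ᶻ F S                              ≡⟨ cong (+ b *ᶻ_) (fourier-sign f S) ⟩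
    + b *ᶻ (N +ᶻ -[1+ 1 ] *ᶻ + D)           ≡⟨ lemma₁ (+ b) N (+ D) ⟩
    + b *ᶻ N -ᶻ + 2 *ᶻ (+ b *ᶻ + D)         ≤⟨ ℤ.+-monoʳ-≤ (+ b *ᶻ N) (ℤ.neg-mono-≤ (ℤ.*-monoˡ-≤-nonNeg (+ 2)
                                                 (subst₂ _≤ᶻ_ (ℤ.pos-* a (2 ^ d)) (ℤ.pos-* b D) (+≤+ (far S))))) ⟩
    + b *ᶻ N -ᶻ + 2 *ᶻ (+ a *ᶻ N)           ≡⟨ lemma₂ (+ a) (+ b) N ⟩
    c                                       ∎
    where
    D = ∑[ x ∈ points d ] bit (dot S x xor f x)
    lemma₁ : ∀ b n D → b *ᶻ (n +ᶻ -[1+ 1 ] *ᶻ D) ≡ b *ᶻ n -ᶻ + 2 *ᶻ (b *ᶻ D)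
    lemma₁ = solve-∀ᶻ
    lemma₂ : ∀ a b n → b *ᶻ n -ᶻ + 2 *ᶻ (a *ᶻ n) ≡ (b -ᶻ + 2 *ᶻ a) *ᶻ n
    lemma₂ = solve-∀ᶻ

  T-bound : + b *ᶻ T ≤ᶻ N *ᶻ c
  T-bound = ℤ.*-cancelˡ-≤-pos _ _ N (begin
    N *ᶻ (+ b *ᶻ T)                              ≡⟨ lemma₁ N (+ b) T ⟩
    + b *ᶻ (N *ᶻ T)                              ≡⟨ cong (+ b *ᶻ_) (fourier-triple (sign ∘ f) (sign ∘ f) (sign ∘ f)) ⟨
    + b *ᶻ ∑ℤ (λ S → F S *ᶻ (F S *ᶻ F S))        ≡⟨ ∑ℤ-*ˡ (+ b) (λ S → F S *ᶻ (F S *ᶻ F S)) ⟨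
    ∑ℤ (λ S → + b *ᶻ (F S *ᶻ (F S *ᶻ F S)))      ≡⟨ ∑ℤ-cong (λ S → ℤ.*-assoc (+ b) (F S) (F S *ᶻ F S)) ⟨
    -- Only an upper bound on `F S` is available and `c` may be negative, but the remaining factor
    -- is a square.
    ∑ℤ (λ S → + b *ᶻ F S *ᶻ (F S *ᶻ F S))        ≤⟨ ∑ℤ-mono-≤ (λ S → ℤ.*-monoʳ-≤-nonNeg (F S *ᶻ F S)
                                                      {{nonNegative (square-nonNeg (F S))}} (F-bound S)) ⟩
    ∑ℤ (λ S → c *ᶻ (F S *ᶻ F S))                 ≡⟨ ∑ℤ-*ˡ c (λ S → F S *ᶻ F S) ⟩
    c *ᶻ ∑ℤ (λ S → F S *ᶻ F S)                   ≡⟨ cong (c *ᶻ_) (trans (parseval (sign ∘ f)) (cong (N *ᶻ_) (∑-sign² f))) ⟩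
    c *ᶻ (N *ᶻ N)                                ≡⟨ lemma₂ c N ⟩
    N *ᶻ (N *ᶻ c)                                ∎)
    where
    lemma₁ : ∀ n b t → n *ᶻ (b *ᶻ t) ≡ b *ᶻ (n *ᶻ t)
    lemma₁ = solve-∀ᶻ
    lemma₂ : ∀ c n → c *ᶻ (n *ᶻ n) ≡ n *ᶻ (n *ᶻ c)
    lemma₂ = solve-∀ᶻ

  2-cancelled : + a *ᶻ (N *ᶻ N) ≤ᶻ + b *ᶻ + V
  2-cancelled = ℤ.*-cancelˡ-≤-pos _ _ (+ 2) (ℤ.0≤i-j⇒j≤i (begin
    0ℤ                                                   ≤⟨ ℤ.i≤j⇒0≤j-i T-bound ⟩
    N *ᶻ c -ᶻ + b *ᶻ T                                   ≡⟨ cong (λ t → N *ᶻ c -ᶻ + b *ᶻ t) (triple-sign f) ⟩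
    N *ᶻ c -ᶻ + b *ᶻ (N *ᶻ N +ᶻ -[1+ 1 ] *ᶻ + V)         ≡⟨ lemma (+ a) (+ b) N (+ V) ⟩
    + 2 *ᶻ (+ b *ᶻ + V) -ᶻ + 2 *ᶻ (+ a *ᶻ (N *ᶻ N))      ∎))
    where
    lemma : ∀ a b n v → n *ᶻ ((b -ᶻ + 2 *ᶻ a) *ᶻ n) -ᶻ b *ᶻ (n *ᶻ n +ᶻ -[1+ 1 ] *ᶻ v) ≡
                        + 2 *ᶻ (b *ᶻ v) -ᶻ + 2 *ᶻ (a *ᶻ (n *ᶻ n))
    lemma = solve-∀ᶻ

-- Linear functions as characters

sum-filter : ∀ {A : Set} {P : A → Set} (P? : Decidable P) (g : A → ℕ) L →
  sum (map g (filter P? L)) ≡ ∑[ a ∈ L ] bit (does (P? a)) * g a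
sum-filter P? g []      = refl
sum-filter P? g (a ∷ L) with does (P? a)
... | true  = cong₂ _+_ (sym (+-identityʳ (g a))) (sum-filter P? g L)
... | false = sum-filter P? g L

bit-xor : ∀ a b → bit (a xor b) ≡ (bit a + bit b) % 2
bit-xor false false = refl
bit-xor false true  = refl
bit-xor true  false = refl
bit-xor true  true  = refl

bit-∧ : ∀ a b → bit (a ∧ b) ≡ bit a * bit b
bit-∧ false b = refl
bit-∧ true  b = sym (+-identityʳ (bit b))

bit-injective : ∀ a b → bit a ≡ bit b → a ≡ b
bit-injective false false _ = refl
bit-injective true  true  _ = refl

dot≡∑ : (S : Subset d) (x : Point d) →
  bit (dot S x) ≡ (∑[ i ∈ allFin d ] bit (does (i ∈? S)) * bit (lookup x i)) % 2
dot≡∑ []      []      = refl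
dot≡∑ {suc d} (s ∷ S) (b ∷ x) = begin
  bit ((s ∧ b) xor dot S x)              ≡⟨ bit-xor (s ∧ b) (dot S x) ⟩
  (bit (s ∧ b) + bit (dot S x)) % 2      ≡⟨ cong₂ (λ p q → (p + q) % 2) (head≡ s) (dot≡∑ S x) ⟩
  (w zero + tail % 2) % 2                ≡⟨ cong (λ p → (p + tail % 2) % 2) (sym (w%2 s b)) ⟩
  (w zero % 2 + tail % 2) % 2            ≡⟨ %-distribˡ-+ (w zero) tail 2 ⟨
  (w zero + tail) % 2                    ≡⟨ cong (_% 2) (∑-allFin d w) ⟨
  ∑ (allFin (suc d)) w % 2               ∎
  where
  open ≡-Reasoning
  w : Fin (suc d) → ℕ
  w i = bit (does (i ∈? (s ∷ S))) * bit (lookup (b ∷ x) i)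
  tail = ∑[ i ∈ allFin d ] bit (does (i ∈? S)) * bit (lookup x i)
  head≡ : ∀ s → bit (s ∧ b) ≡ bit (does (zero {d} ∈? (s ∷ S))) * bit b
  head≡ false = refl
  head≡ true  = bit-∧ true b
  w%2 : ∀ s b → bit (does (zero {d} ∈? (s ∷ S))) * bit b % 2 ≡ bit (does (zero {d} ∈? (s ∷ S))) * bit b
  w%2 false b     = refl
  w%2 true  false = refl
  w%2 true  true  = refl

dot-linear : (S : Subset d) → Linear (dot S)
dot-linear {d} S = S , λ x → trans (dot≡∑ S x)
  (cong (_% 2) (sym (sum-filter (_∈? S) (λ i → bit (lookup x i)) (allFin d))))

linear⇒dot : (f : Input d) ((S , _) : Linear f) → ∀ x → f x ≡ dot S x
linear⇒dot f (S , f≡) x = bit-injective (f x) (dot S x) (trans (f≡ x) (sym (proj₂ (dot-linear S) x)))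

dot-⊕ : (S : Vec Bool d) (x y : Point d) → dot S x xor (dot S y xor dot S (x ⊕ y)) ≡ false
dot-⊕ []      []      []      = refl
dot-⊕ (s ∷ S) (a ∷ x) (b ∷ y) = trans (lemma s a b (dot S x) (dot S y) (dot S (x ⊕ y))) (dot-⊕ S x y)
  where
  open xor-∧-Solver
  lemma : ∀ s a b p q r →
    ((s ∧ a) xor p) xor (((s ∧ b) xor q) xor ((s ∧ (a xor b)) xor r)) ≡ p xor (q xor r)
  lemma = solve 6 (λ s a b p q r →
    ((s :* a) :+ p) :+ (((s :* b) :+ q) :+ ((s :* (a :+ b)) :+ r)) := p :+ (q :+ r)) refl

linear⇒no-violation : (f : Input d) → Linear f → ∀ x y → violation f x y ≡ false
linear⇒no-violation f lin@(S , _) x y rewrite linear⇒dot f lin x | linear⇒dot f lin y | linear⇒dot f lin (x ⊕ y) = dot-⊕ S x y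

-- Erasures met by a sequence of queries

open module ∈ₚ {d} = DecMembership (≡-dec {n = d} Bool._≟_) using () renaming (_∈?_ to _∈ₚ?_)

_∈ᵇ_ : Point d → List (Point d) → Bool
x ∈ᵇ E = does (x ∈ₚ? E)

∈ᵇ-++ : (x : Point d) (D E : List (Point d)) → x ∈ᵇ (D ++ E) ≡ (x ∈ᵇ D) ∨ (x ∈ᵇ E)
∈ᵇ-++ x []      E = refl
∈ᵇ-++ x (z ∷ D) E with does (x ≟ₚ z)
... | true  = refl
... | false = ∈ᵇ-++ x D E

-- A union bound over the erased points. The multiplicity `M` enters because `q` need not be
-- injective: several pairs of reserve indices can have the same sum.
∑-∈ᵇ : ∀ {A : Set} (L : List A) (q : A → Point d) M →
  (∀ z → ∑[ a ∈ L ] bit (does (q a ≟ₚ z)) ≤ M) →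
  ∀ E → ∑[ a ∈ L ] bit (q a ∈ᵇ E) ≤ M * length E
∑-∈ᵇ L q M mult []      = ≤-trans (≤-reflexive (∑-zero L)) z≤n
∑-∈ᵇ L q M mult (z ∷ E) = begin
  ∑[ a ∈ L ] bit (q a ∈ᵇ (z ∷ E))                                 ≤⟨ ∑-mono-≤ L (λ a → bit-∨ (does (q a ≟ₚ z)) (q a ∈ᵇ E)) ⟩
  ∑[ a ∈ L ] (bit (does (q a ≟ₚ z)) + bit (q a ∈ᵇ E))             ≡⟨ ∑-distrib-+ L _ _ ⟩
  ∑ L (λ a → bit (does (q a ≟ₚ z))) + ∑ L (λ a → bit (q a ∈ᵇ E))  ≤⟨ +-mono-≤ (mult z) (∑-∈ᵇ L q M mult E) ⟩
  M + M * length E                                                ≡⟨ *-suc M (length E) ⟨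
  M * suc (length E)                                              ∎
  where
  open ≤-Reasoning
  bit-∨ : ∀ a b → bit (a ∨ b) ≤ bit a + bit b
  bit-∨ false b = ≤-refl
  bit-∨ true  b = s≤s z≤n

askAll : Vec (Point d) n → (Vec Answer n → Algorithm d) → Algorithm d
askAll []       κ = κ []
askAll (x ∷ xs) κ = query x (λ a → askAll xs (κ ∘ (a ∷_)))

HasQueries-askAll : ∀ (xs : Vec (Point d) n) {ys κ} → (∀ as → HasQueries ys (κ as)) →
                 HasQueries (Vec.toList xs ++ ys) (askAll xs κ)
HasQueries-askAll []       hq = hq []
HasQueries-askAll (x ∷ xs) hq = ask λ a → HasQueries-askAll xs (λ as → hq (a ∷ as))

HasQueries⇒numQueries : ∀ {xs} {A : Algorithm d} → HasQueries xs A → numQueries A ≡ length xs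
HasQueries⇒numQueries done = refl
HasQueries⇒numQueries (ask {xs = xs} {k} hq)
  rewrite HasQueries⇒numQueries (hq nothing) | HasQueries⇒numQueries (hq (just false))
        | HasQueries⇒numQueries (hq (just true)) =
  cong suc (trans (cong (length xs ⊔_) (⊔-idem (length xs))) (⊔-idem (length xs)))

module _ {d t : ℕ} (S : Strategy d t) (f : Input d) where

  -- The erased points and the history, provided that no query so far has been
  -- answered by an erasure.
  State : Set
  State = List (Point d) × History d

  step : State → Point d → State
  step (E , h) x = toList (S f ((x , just (f x)) ∷ h)) ++ E , (x , just (f x)) ∷ h

  steps : State → Vec (Point d) n → State
  steps σ []       = σ
  steps σ (x ∷ xs) = steps (step σ x) xs

  -- Counted along the idealised run, which continues with true answers even after a hit. What
  -- happens after the first hit differs from the real run, but one hit already makes the bound on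
  -- acceptance trivial.
  hits : State → Vec (Point d) n → ℕ
  hits σ []       = 0
  hits σ (x ∷ xs) = bit (x ∈ᵇ proj₁ σ) + hits (step σ x) xs

  length-step : ∀ σ x → length (proj₁ (step σ x)) ≤ length (proj₁ σ) + t
  length-step (E , h) x = begin
    length (toList es ++ E)       ≡⟨ length-++ (toList es) ⟩
    length (toList es) + length E ≡⟨ cong (_+ length E) (length-toList (Vec≤.vec es)) ⟩
    _ + length E                  ≤⟨ +-monoˡ-≤ (length E) (isBounded es) ⟩
    t + length E                  ≡⟨ +-comm t _ ⟩
    length E + t                  ∎
    where
    open ≤-Reasoning
    es = S f ((x , just (f x)) ∷ h)

  length-steps : ∀ σ (xs : Vec (Point d) n) → length (proj₁ (steps σ xs)) ≤ length (proj₁ σ) + t * n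
  length-steps σ [] = m≤m+n _ _
  length-steps {suc n} σ (x ∷ xs) = begin
    length (proj₁ (steps (step σ x) xs)) ≤⟨ length-steps (step σ x) xs ⟩
    length (proj₁ (step σ x)) + t * n    ≤⟨ +-monoˡ-≤ (t * n) (length-step σ x) ⟩
    length (proj₁ σ) + t + t * n         ≡⟨ lemma (length (proj₁ σ)) t n ⟩
    length (proj₁ σ) + t * suc n         ∎
    where
    open ≤-Reasoning
    lemma : ∀ e t n → e + t + t * n ≡ e + t * suc n
    lemma = solve-∀

  -- The erasures in force at a draw depend only on earlier draws, so a fresh draw meets each of
  -- them with probability at most `M` over the length of `L`. The induction peels off the first
  -- draw and bounds the others for every state it can lead to.
  ∑-hits : ∀ {A : Set} (L : List A) (q : A → Point d) M →
    (∀ z → ∑[ a ∈ L ] bit (does (q a ≟ₚ z)) ≤ M) → ∀ n σ →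
    length L * (∑[ v ∈ vecs L n ] hits σ (Vec.map q v)) ≤
    length L ^ n * (M * (n * (length (proj₁ σ) + t * n)))
  ∑-hits L q M mult zero    σ = ≤-trans (≤-reflexive (*-zeroʳ (length L))) z≤n
  ∑-hits L q M mult (suc n) σ = begin
    ℓ * (∑[ v ∈ vecs L (suc n) ] hits σ (Vec.map q v))
      ≡⟨ cong (ℓ *_) (∑-vecs L n _) ⟩
    ℓ * (∑[ a ∈ L ] ∑[ v ∈ vecs L n ] (bit (q a ∈ᵇ proj₁ σ) + rest a v))
      ≡⟨ cong (ℓ *_) (∑-cong L (λ a → ∑-distrib-+ (vecs L n) _ _)) ⟩
    ℓ * (∑[ a ∈ L ] ((∑[ _ ∈ vecs L n ] bit (q a ∈ᵇ proj₁ σ)) + ∑ (vecs L n) (rest a)))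
      ≡⟨ cong (ℓ *_) (∑-distrib-+ L _ _) ⟩
    ℓ * ((∑[ a ∈ L ] ∑[ _ ∈ vecs L n ] bit (q a ∈ᵇ proj₁ σ)) + (∑[ a ∈ L ] ∑ (vecs L n) (rest a)))
      ≡⟨ *-distribˡ-+ ℓ _ _ ⟩
    ℓ * (∑[ a ∈ L ] ∑[ _ ∈ vecs L n ] bit (q a ∈ᵇ proj₁ σ)) + ℓ * (∑[ a ∈ L ] ∑ (vecs L n) (rest a))
      ≤⟨ +-mono-≤ (*-monoʳ-≤ ℓ now) later ⟩
    ℓ * (ℓ ^ n * (M * e)) + ℓ * (ℓ ^ n * (M * (n * (e + t + t * n))))
      ≡⟨ lemma₁ ℓ (ℓ ^ n) M e n t ⟩
    ℓ * ℓ ^ n * (M * (e + n * (e + t * suc n)))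
      -- The first draw faces only `e` erasures, but it is charged the final budget like every other
      -- draw.
      ≤⟨ *-monoʳ-≤ (ℓ * ℓ ^ n) (*-monoʳ-≤ M (+-monoˡ-≤ (n * (e + t * suc n)) (m≤m+n e (t * suc n)))) ⟩
    ℓ * ℓ ^ n * (M * (suc n * (e + t * suc n)))
      ∎
    where
    open ≤-Reasoning
    ℓ = length L
    e = length (proj₁ σ)
    rest : _ → Vec _ n → ℕ
    rest a v = hits (step σ (q a)) (Vec.map q v)
    now : ∑[ a ∈ L ] ∑[ _ ∈ vecs L n ] bit (q a ∈ᵇ proj₁ σ) ≤ ℓ ^ n * (M * e)
    now = begin
      ∑[ a ∈ L ] ∑[ _ ∈ vecs L n ] bit (q a ∈ᵇ proj₁ σ)     ≡⟨ ∑-cong L (λ a → ∑-const (vecs L n) _) ⟩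
      ∑[ a ∈ L ] length (vecs L n) * bit (q a ∈ᵇ proj₁ σ)   ≡⟨ ∑-*ˡ L (length (vecs L n)) _ ⟨
      length (vecs L n) * (∑[ a ∈ L ] bit (q a ∈ᵇ proj₁ σ)) ≤⟨ *-monoʳ-≤ (length (vecs L n)) (∑-∈ᵇ L q M mult (proj₁ σ)) ⟩
      length (vecs L n) * (M * e)                           ≡⟨ cong (_* (M * e)) (length-vecs L n) ⟩
      ℓ ^ n * (M * e)                                       ∎
    later : ℓ * (∑[ a ∈ L ] ∑ (vecs L n) (rest a)) ≤ ℓ * (ℓ ^ n * (M * (n * (e + t + t * n))))
    later = begin
      ℓ * (∑[ a ∈ L ] ∑ (vecs L n) (rest a))                ≡⟨ ∑-*ˡ L ℓ _ ⟩
      ∑[ a ∈ L ] ℓ * ∑ (vecs L n) (rest a)                  ≤⟨ ∑-mono-≤ L (λ a → ≤-trans (∑-hits L q M mult n (step σ (q a)))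
                                                                 (*-monoʳ-≤ (ℓ ^ n) (*-monoʳ-≤ M (*-monoʳ-≤ n
                                                                   (+-monoˡ-≤ (t * n) (length-step σ (q a))))))) ⟩
      ∑[ _ ∈ L ] ℓ ^ n * (M * (n * (e + t + t * n)))        ≡⟨ ∑-const L _ ⟩
      ℓ * (ℓ ^ n * (M * (n * (e + t + t * n))))             ∎
    lemma₁ : ∀ ℓ p M e n t → ℓ * (p * (M * e)) + ℓ * (p * (M * (n * (e + t + t * n)))) ≡
                             ℓ * p * (M * (e + n * (e + t * suc n)))
    lemma₁ = solve-∀

  Unerased : Oracle d → List (Point d) → Set
  Unerased O E = ∀ x → x ∈ᵇ E ≡ false → O x ≡ just (f x)

  Unerased-erase : ∀ {O E} D → Unerased O E → Unerased (erase D O) (D ++ E)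
  Unerased-erase {O} {E} D un x x∉ with x ∈ᵇ D | ∈ᵇ-++ x D E
  ... | false | eq = un x (trans (sym eq) x∉)
  ... | true  | eq with () ← trans (sym eq) x∉

  -- Without hits every answer is the true one, so the real history, and with it the strategy's
  -- choices, never departs from the idealised run.
  execute-askAll-unerased : ∀ σ (xs : Vec (Point d) n) {κ b O} → Unerased O (proj₁ σ) → hits σ xs ≡ 0 →
    (∀ O′ → Unerased O′ (proj₁ (steps σ xs)) →
       execute S f O′ (proj₂ (steps σ xs)) (κ (Vec.map (just ∘ f) xs)) ≡ b) →
    execute S f O (proj₂ σ) (askAll xs κ) ≡ b
  execute-askAll-unerased σ       []       un no-hits cont = cont _ un
  execute-askAll-unerased (E , h) (x ∷ xs) un no-hits cont with x ∈ᵇ E in x∉E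
  execute-askAll-unerased (E , h) (x ∷ xs) {O = O} un no-hits cont | false
    rewrite un x x∉E = execute-askAll-unerased (step (E , h) x) xs
      (Unerased-erase (toList (S f ((x , just (f x)) ∷ h))) un) no-hits cont

  -- Erasures remove values but never falsify them, so this invariant survives every strategy, with
  -- no assumption about hits. It is what makes acceptance of linear functions certain and not
  -- merely likely.
  Consistent : Oracle d → Set
  Consistent O = ∀ x {b} → O x ≡ just b → b ≡ f x

  Consistent-erase : ∀ {O} D → Consistent O → Consistent (erase D O)
  Consistent-erase D con x eq with x ∈ᵇ D
  ... | false = con x eq

  execute-askAll-consistent : ∀ (xs : Vec (Point d) n) {κ b O h} → Consistent O →
    (∀ O′ h′ as → Consistent O′ → (∀ i {c} → lookup as i ≡ just c → c ≡ f (lookup xs i)) →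
       execute S f O′ h′ (κ as) ≡ b) →
    execute S f O h (askAll xs κ) ≡ b
  execute-askAll-consistent []       con cont = cont _ _ [] con (λ ())
  execute-askAll-consistent (x ∷ xs) {O = O} {h} con cont =
    execute-askAll-consistent xs (Consistent-erase (toList (S f ((x , O x) ∷ h))) con)
      λ O′ h′ as con′ as-ok → cont O′ h′ (O x ∷ as) con′ λ { zero → con x ; (suc i) → as-ok i }

-- The test for given random choices

-- An erased answer is never taken as evidence against linearity, which keeps the error one-sided.
violated : Answer → Answer → Answer → Bool
violated (just a) (just b) (just c) = a xor (b xor c)
violated _        _        _        = false

detect : Vec Answer m → Vec Answer m → Vec (Fin m × Fin m) k → Vec Answer k → Bool
detect R R′ []            []       = false
detect R R′ ((i , j) ∷ w) (c ∷ cs) = violated (lookup R i) (lookup R′ j) c ∨ detect R R′ w cs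

sumAt : Vec (Point d) m → Vec (Point d) m → Fin m × Fin m → Point d
sumAt x y (i , j) = lookup x i ⊕ lookup y j

-- The pairs `w` influence no query before the last phase, so the erasures made while the reserve is
-- queried cannot depend on them.
test : Vec (Point d) m → Vec (Point d) m → Vec (Fin m × Fin m) k → Algorithm d
test x y w = askAll x λ R → askAll y λ R′ → askAll (Vec.map (sumAt x y) w) λ cs → output (not (detect R R′ w cs))

test-queries : (x y : Vec (Point d) m) (w : Vec (Fin m × Fin m) k) →
  HasQueries (Vec.toList x ++ Vec.toList y ++ Vec.toList (Vec.map (sumAt x y) w) ++ []) (test x y w)
test-queries x y w = HasQueries-askAll x λ _ → HasQueries-askAll y λ _ → HasQueries-askAll (Vec.map (sumAt x y) w) λ _ → done

numQueries-test : (x y : Vec (Point d) m) (w : Vec (Fin m × Fin m) k) → numQueries (test x y w) ≡ m + (m + k)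
numQueries-test {m = m} {k = k} x y w = trans (HasQueries⇒numQueries (test-queries x y w))
  (trans (length-++-toList x _) (cong (_+_ m) (trans (length-++-toList y _) (cong (_+_ m)
    (trans (length-++-toList (Vec.map (sumAt x y) w) []) (+-identityʳ k))))))
  where
  length-++-toList : ∀ {A : Set} {n} (v : Vec A n) (L : List A) → length (Vec.toList v ++ L) ≡ n + length L
  length-++-toList v L = trans (length-++ (Vec.toList v)) (cong (_+ length L) (length-toList v))

violationAt : Input d → Vec (Point d) m → Vec (Point d) m → Fin m × Fin m → ℕ
violationAt f x y (i , j) = bit (violation f (lookup x i) (lookup y j))

sumᵛ : ∀ {A : Set} → (A → ℕ) → Vec A n → ℕ
sumᵛ g []       = 0
sumᵛ g (a ∷ v) = g a + sumᵛ g v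

detect-linear : (f : Input d) → (∀ x y → violation f x y ≡ false) →
  ∀ (x y : Vec (Point d) m) (w : Vec (Fin m × Fin m) k) R R′ cs →
  (∀ i {c} → lookup R i ≡ just c → c ≡ f (lookup x i)) →
  (∀ i {c} → lookup R′ i ≡ just c → c ≡ f (lookup y i)) →
  (∀ i {c} → lookup cs i ≡ just c → c ≡ f (lookup (Vec.map (sumAt x y) w) i)) →
  detect R R′ w cs ≡ false
detect-linear f lin x y []            R R′ []       R-ok R′-ok cs-ok = refl
detect-linear f lin x y ((i , j) ∷ w) R R′ (c ∷ cs) R-ok R′-ok cs-ok =
  cong₂ _∨_ (lemma (lookup R i) (lookup R′ j) c (R-ok i) (R′-ok j) (cs-ok zero))
            (detect-linear f lin x y w R R′ cs R-ok R′-ok (cs-ok ∘ suc))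
  where
  lemma : ∀ p q r → (∀ {c} → p ≡ just c → c ≡ f (lookup x i)) → (∀ {c} → q ≡ just c → c ≡ f (lookup y j)) →
          (∀ {c} → r ≡ just c → c ≡ f (sumAt x y (i , j))) → violated p q r ≡ false
  lemma (just a) (just b) (just c) p-ok q-ok r-ok
    rewrite p-ok refl | q-ok refl | r-ok refl = lin (lookup x i) (lookup y j)
  lemma nothing  _        _        _ _ _ = refl
  lemma (just _) nothing  _        _ _ _ = refl
  lemma (just _) (just _) nothing  _ _ _ = refl

test-accepts-linear : ∀ (S : Strategy d t) f → Linear f → ∀ (x y : Vec (Point d) m) (w : Vec (Fin m × Fin m) k) →
  outcome S f (test x y w) ≡ true
test-accepts-linear S f lin x y w =
  execute-askAll-consistent S f x (λ _ → λ { refl → refl }) λ _ _ R con R-ok →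
  execute-askAll-consistent S f y con λ _ _ R′ con R′-ok →
  execute-askAll-consistent S f (Vec.map (sumAt x y) w) con λ _ _ cs _ cs-ok →
  cong not (detect-linear f (linear⇒no-violation f lin) x y w R R′ cs R-ok R′-ok cs-ok)

detect-violation : (f : Input d) (x y : Vec (Point d) m) (w : Vec (Fin m × Fin m) k) →
  detect (Vec.map (just ∘ f) x) (Vec.map (just ∘ f) y) w (Vec.map (just ∘ f) (Vec.map (sumAt x y) w)) ≡ false →
  sumᵛ (violationAt f x y) w ≡ 0
detect-violation f x y []            _  = refl
detect-violation f x y ((i , j) ∷ w) eq
  rewrite lookup-map i (just ∘ f) x | lookup-map j (just ∘ f) y
  with violation f (lookup x i) (lookup y j)
... | false = detect-violation f x y w eq

module _ {d t : ℕ} (S : Strategy d t) (f : Input d) where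

  totalHits : (x y : Vec (Point d) m) (w : Vec (Fin m × Fin m) k) → ℕ
  totalHits x y w = hits S f σ₀ x + (hits S f σ₁ y + hits S f (steps S f σ₁ y) (Vec.map (sumAt x y) w))
    where
    σ₀ = [] , []
    σ₁ = steps S f σ₀ x

  -- The union bound for a single outcome of the coins: if there is no hit, all answers are true,
  -- and then acceptance means that no drawn pair is violated.
  acceptance≤ : ∀ (x y : Vec (Point d) m) (w : Vec (Fin m × Fin m) k) →
    bit (does (outcome S f (test x y w) Bool.≟ true)) ≤
    totalHits x y w + bit (does (sumᵛ (violationAt f x y) w ≟ 0))
  acceptance≤ x y w with totalHits x y w in eq
  ... | suc _ = ≤-trans (bit≤1 _) (s≤s z≤n)
  ... | zero with detect (Vec.map (just ∘ f) x) (Vec.map (just ∘ f) y) w (Vec.map (just ∘ f) (Vec.map (sumAt x y) w)) in det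
  ...   | false rewrite detect-violation f x y w det = bit≤1 _
  ...   | true  = subst (λ b → bit (does (b Bool.≟ true)) ≤ _) (sym rejects) z≤n
    where
    σ₀ = [] , []
    σ₁ = steps S f σ₀ x
    eq′ = m+n≡0⇒n≡0 (hits S f σ₀ x) eq
    rejects : outcome S f (test x y w) ≡ false
    rejects =
      execute-askAll-unerased S f σ₀ x (λ _ _ → refl) (m+n≡0⇒m≡0 _ eq) λ _ un →
      execute-askAll-unerased S f σ₁ y un (m+n≡0⇒m≡0 _ eq′) λ _ un →
      execute-askAll-unerased S f (steps S f σ₁ y) (Vec.map (sumAt x y) w) un (m+n≡0⇒n≡0 (hits S f σ₁ y) eq′) λ _ _ →
      cong not det

-- Multiplicities and moments of random samples

bit-≤ : ∀ {P Q : Set} (P? : Dec P) (Q? : Dec Q) → (P → Q) → bit (does P?) ≤ bit (does Q?)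
bit-≤ (no _)  _       P⇒Q = z≤n
bit-≤ (yes p) (yes _) P⇒Q = ≤-refl
bit-≤ (yes p) (no ¬q) P⇒Q = ⊥-elim (¬q (P⇒Q p))

-- Bounding the largest multiplicity by the total number of collisions is wasteful but sufficient,
-- since the expected total will be at most 1/16. Of `same`, only its row sums enter the bound.
collisions : List A → (A → A → Bool) → (A → Point d) → ℕ
collisions L same q = ∑[ a ∈ L ] ∑[ b ∈ L ] bit (not (same a b)) * bit (does (q a ≟ₚ q b))

-- If c elements are mapped to z, then c² ≤ c + collisions.
multiplicity≤ : ∀ (L : List A) (same : A → A → Bool) (q : A → Point d) →
  (∀ a → ∑[ b ∈ L ] bit (same a b) ≡ 1) →
  ∀ z → ∑[ a ∈ L ] bit (does (q a ≟ₚ z)) ≤ 1 + collisions L same q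
multiplicity≤ L same q same≡1 z = cancel c (begin
  c * c                                                     ≡⟨ ∑-* L L _ _ ⟩
  ∑[ a ∈ L ] ∑[ b ∈ L ] e a * e b                           ≤⟨ ∑-mono-≤ L (λ a → ∑-mono-≤ L (pointwise a)) ⟩
  ∑[ a ∈ L ] ∑[ b ∈ L ] (e a * bit (same a b) + r a b)      ≡⟨ ∑-cong L (λ a → ∑-distrib-+ L _ _) ⟩
  ∑[ a ∈ L ] ((∑[ b ∈ L ] e a * bit (same a b)) + ∑ L (r a)) ≡⟨ ∑-distrib-+ L _ _ ⟩
  (∑[ a ∈ L ] ∑[ b ∈ L ] e a * bit (same a b)) + collisions L same q
    ≡⟨ cong (_+ collisions L same q) (∑-cong L λ a → trans (sym (∑-*ˡ L (e a) _)) (trans (cong (e a *_) (same≡1 a)) (*-identityʳ (e a)))) ⟩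
  c + collisions L same q                                   ∎)
  where
  open ≤-Reasoning
  e : _ → ℕ
  e a = bit (does (q a ≟ₚ z))
  r : _ → _ → ℕ
  r a b = bit (not (same a b)) * bit (does (q a ≟ₚ q b))
  c = ∑ L e
  pointwise : ∀ a b → e a * e b ≤ e a * bit (same a b) + r a b
  pointwise a b with same a b
  ... | true  = ≤-trans (*-monoʳ-≤ (e a) (bit≤1 _)) (m≤m+n _ _)
  ... | false with q a ≟ₚ z | q b ≟ₚ z
  ...   | no _  | _     = z≤n
  ...   | yes _ | no _  = z≤n
  ...   | yes p | yes p′ with q a ≟ₚ q b
  ...     | yes _ = ≤-refl
  ...     | no ¬p = ⊥-elim (¬p (trans p (sym p′)))
  cancel : ∀ c {r} → c * c ≤ c + r → c ≤ 1 + r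
  cancel zero    _  = z≤n
  -- After cancelling one copy of the multiplicity, c(c + 1) ≤ r remains, hence c ≤ r.
  cancel (suc c) le = s≤s (≤-trans (m≤m*n c (suc c)) (+-cancelˡ-≤ (suc c) _ _ le))

∑-sumᵛ : ∀ (L : List A) (z : A → ℕ) n →
  length L * (∑[ v ∈ vecs L n ] sumᵛ z v) ≡ length L ^ n * (n * ∑ L z)
∑-sumᵛ L z zero    = *-zeroʳ (length L)
∑-sumᵛ L z (suc n) = begin
  ℓ * (∑[ v ∈ vecs L (suc n) ] sumᵛ z v)                    ≡⟨ cong (ℓ *_) (∑-vecs L n _) ⟩
  ℓ * (∑[ a ∈ L ] ∑[ v ∈ vecs L n ] (z a + sumᵛ z v))       ≡⟨ cong (ℓ *_) (∑-cong L λ a → ∑-distrib-+ (vecs L n) _ _) ⟩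
  ℓ * (∑[ a ∈ L ] ((∑[ _ ∈ vecs L n ] z a) + S₁))           ≡⟨ cong (ℓ *_) (∑-distrib-+ L _ _) ⟩
  ℓ * ((∑[ a ∈ L ] ∑[ _ ∈ vecs L n ] z a) + (∑[ _ ∈ L ] S₁))
    ≡⟨ cong (ℓ *_) (cong₂ _+_ (∑-cong L λ a → trans (∑-const (vecs L n) (z a)) (cong (_* z a) (length-vecs L n))) (∑-const L S₁)) ⟩
  ℓ * ((∑[ a ∈ L ] ℓ ^ n * z a) + ℓ * S₁)                   ≡⟨ cong₂ (λ p q → ℓ * (p + q)) (sym (∑-*ˡ L (ℓ ^ n) z)) (∑-sumᵛ L z n) ⟩
  ℓ * (ℓ ^ n * s + ℓ ^ n * (n * s))                         ≡⟨ lemma ℓ (ℓ ^ n) n s ⟩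
  ℓ ^ suc n * (suc n * s)                                   ∎
  where
  open ≡-Reasoning
  ℓ = length L
  s = ∑ L z
  S₁ = ∑[ v ∈ vecs L n ] sumᵛ z v
  lemma : ∀ ℓ p n s → ℓ * (p * s + p * (n * s)) ≡ ℓ * p * (suc n * s)
  lemma = solve-∀

-- With p the mean of `z`, this says that the sum of n independent draws has second moment at most
-- np + n²p²: products of distinct draws factor, and squares are absorbed by `z²≤z`, as `z` is an
-- indicator.
∑-sumᵛ² : ∀ (L : List A) (z : A → ℕ) → (∀ a → z a * z a ≤ z a) → ∀ n →
  length L * length L * (∑[ v ∈ vecs L n ] sumᵛ z v * sumᵛ z v) ≤
  length L ^ n * (n * (length L * ∑ L z) + n * n * (∑ L z * ∑ L z))
∑-sumᵛ² L z z²≤z zero    = ≤-trans (≤-reflexive (*-zeroʳ (length L * length L))) z≤n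
∑-sumᵛ² L z z²≤z (suc n) = begin
  ℓ * ℓ * (∑[ v ∈ vecs L (suc n) ] sumᵛ z v * sumᵛ z v)
    ≡⟨ cong (ℓ * ℓ *_) (∑-vecs L n _) ⟩
  ℓ * ℓ * (∑[ a ∈ L ] ∑[ v ∈ vecs L n ] (z a + sumᵛ z v) * (z a + sumᵛ z v))
    ≤⟨ *-monoʳ-≤ (ℓ * ℓ) (∑-mono-≤ L λ a → ∑-mono-≤ (vecs L n) (pointwise a)) ⟩
  ℓ * ℓ * (∑[ a ∈ L ] ∑[ v ∈ vecs L n ] (z a + (2 * z a * sumᵛ z v + sumᵛ z v * sumᵛ z v)))
    ≡⟨ cong (ℓ * ℓ *_) (∑-cong L inner) ⟩
  ℓ * ℓ * (∑[ a ∈ L ] (p * z a + (2 * S₁ * z a + S₂)))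
    ≡⟨ cong (ℓ * ℓ *_) outer ⟩
  ℓ * ℓ * (p * s + (2 * S₁ * s + ℓ * S₂))
    ≡⟨ lemma₁ ℓ p s S₁ S₂ ⟩
  ℓ * (ℓ * p * s + 2 * s * (ℓ * S₁) + ℓ * ℓ * S₂)
    ≤⟨ *-monoʳ-≤ ℓ (+-mono-≤ (≤-reflexive (cong (λ q → ℓ * p * s + 2 * s * q) (∑-sumᵛ L z n))) (∑-sumᵛ² L z z²≤z n)) ⟩
  ℓ * (ℓ * p * s + 2 * s * (p * (n * s)) + p * (n * (ℓ * s) + n * n * (s * s)))
    -- The recursion produces n² + 2n copies of s²; one more completes them to (n + 1)².
    ≤⟨ m≤m+n _ (ℓ * p * (s * s)) ⟩
  ℓ * (ℓ * p * s + 2 * s * (p * (n * s)) + p * (n * (ℓ * s) + n * n * (s * s))) + ℓ * p * (s * s)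
    ≡⟨ lemma₂ ℓ p s n ⟩
  ℓ * p * (suc n * (ℓ * s) + suc n * suc n * (s * s)) ∎
  where
  open ≤-Reasoning
  ℓ = length L
  p = ℓ ^ n
  s = ∑ L z
  S₁ = ∑[ v ∈ vecs L n ] sumᵛ z v
  S₂ = ∑[ v ∈ vecs L n ] sumᵛ z v * sumᵛ z v
  square : ∀ a b → (a + b) * (a + b) ≡ a * a + (2 * a * b + b * b)
  square = solve-∀
  pointwise : ∀ a v → (z a + sumᵛ z v) * (z a + sumᵛ z v) ≤ z a + (2 * z a * sumᵛ z v + sumᵛ z v * sumᵛ z v)
  pointwise a v = ≤-trans (≤-reflexive (square (z a) (sumᵛ z v))) (+-monoˡ-≤ _ (z²≤z a))
  swap : ∀ a b → 2 * a * b ≡ 2 * b * a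
  swap = solve-∀
  inner : ∀ a → ∑[ v ∈ vecs L n ] (z a + (2 * z a * sumᵛ z v + sumᵛ z v * sumᵛ z v)) ≡ p * z a + (2 * S₁ * z a + S₂)
  inner a = trans (∑-distrib-+ (vecs L n) _ _) (cong₂ _+_
    (trans (∑-const (vecs L n) (z a)) (cong (_* z a) (length-vecs L n)))
    (trans (∑-distrib-+ (vecs L n) _ _) (cong (_+ S₂)
      (trans (sym (∑-*ˡ (vecs L n) (2 * z a) _)) (swap (z a) S₁)))))
  outer : ∑[ a ∈ L ] (p * z a + (2 * S₁ * z a + S₂)) ≡ p * s + (2 * S₁ * s + ℓ * S₂)
  outer = trans (∑-distrib-+ L _ _) (cong₂ _+_ (sym (∑-*ˡ L p z))
    (trans (∑-distrib-+ L _ _) (cong₂ _+_ (sym (∑-*ˡ L (2 * S₁) z)) (∑-const L S₂))))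
  lemma₁ : ∀ ℓ p s S₁ S₂ → ℓ * ℓ * (p * s + (2 * S₁ * s + ℓ * S₂)) ≡ ℓ * (ℓ * p * s + 2 * s * (ℓ * S₁) + ℓ * ℓ * S₂)
  lemma₁ = solve-∀
  lemma₂ : ∀ ℓ p s n →
    ℓ * (ℓ * p * s + 2 * s * (p * (n * s)) + p * (n * (ℓ * s) + n * n * (s * s))) + ℓ * p * (s * s) ≡
    ℓ * p * (suc n * (ℓ * s) + suc n * suc n * (s * s))
  lemma₂ = solve-∀

-- Nonnegativity of (b - a)². Truncated subtraction is avoided by writing the larger number as the
-- smaller one plus `r`.
am-gm : ∀ a b → 2 * a * b ≤ b * b + a * a
am-gm a b with ≤-total a b
... | inj₁ a≤b with r , refl ← m≤n⇒∃[o]m+o≡n a≤b = ≤-trans (m≤m+n _ (r * r)) (≤-reflexive (lemma a r))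
  where
  lemma : ∀ a r → 2 * a * (a + r) + r * r ≡ (a + r) * (a + r) + a * a
  lemma = solve-∀
... | inj₂ b≤a with r , refl ← m≤n⇒∃[o]m+o≡n b≤a = ≤-trans (m≤m+n _ (r * r)) (≤-reflexive (lemma b r))
  where
  lemma : ∀ b r → 2 * (b + r) * b + r * r ≡ b * b + (b + r) * (b + r)
  lemma = solve-∀

pairs : ∀ m → List (Fin m × Fin m)
pairs m = cartesianProduct (allFin m) (allFin m)

∑-allFin-const : ∀ m c → ∑[ _ ∈ allFin m ] c ≡ m * c
∑-allFin-const m c = trans (∑-const (allFin m) c) (cong (_* c) (length-tabulate {n = m} (λ i → i)))

∑-pairs-const : ∀ m c → ∑[ _ ∈ pairs m ] c ≡ m * m * c
∑-pairs-const m c = trans (∑-product (allFin m) (allFin m) _)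
  (trans (∑-cong (allFin m) λ _ → ∑-allFin-const m c) (trans (∑-allFin-const m (m * c)) (sym (*-assoc m m c))))

length-pairs : ∀ m → length (pairs m) ≡ m * m
length-pairs m = trans (length≡∑1 (pairs m)) (trans (∑-pairs-const m 1) (*-identityʳ _))

samePair : (p q : Fin m × Fin m) → Bool
samePair (i , j) (i′ , j′) = does (i Fin.≟ i′) ∧ does (j Fin.≟ j′)

∑-samePair : (p : Fin m × Fin m) → ∑[ q ∈ pairs m ] bit (samePair p q) ≡ 1
∑-samePair {m} (i , j) = begin
  ∑[ q ∈ pairs m ] bit (samePair (i , j) q)
    ≡⟨ ∑-product (allFin m) (allFin m) _ ⟩
  ∑[ i′ ∈ allFin m ] ∑[ j′ ∈ allFin m ] bit (does (i Fin.≟ i′) ∧ does (j Fin.≟ j′))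
    ≡⟨ ∑-cong (allFin m) (λ i′ → ∑-cong (allFin m) λ j′ → bit-∧ (does (i Fin.≟ i′)) _) ⟩
  ∑[ i′ ∈ allFin m ] ∑[ j′ ∈ allFin m ] bit (does (i Fin.≟ i′)) * bit (does (j Fin.≟ j′))
    ≡⟨ ∑-* (allFin m) (allFin m) _ _ ⟨
  (∑[ i′ ∈ allFin m ] bit (does (i Fin.≟ i′))) * (∑[ j′ ∈ allFin m ] bit (does (j Fin.≟ j′)))
    ≡⟨ cong₂ _*_ (∑-allFin-≟ i) (∑-allFin-≟ j) ⟩
  1 ∎
  where open ≡-Reasoning

-- A count instead of a truth value: equal pairs get 2, which is harmless in an upper bound and
-- makes every row sum exactly 2m.
shared : (p q : Fin m × Fin m) → ℕ
shared (i , j) (i′ , j′) = bit (does (i Fin.≟ i′)) + bit (does (j Fin.≟ j′))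

∑-shared : (p : Fin m × Fin m) → ∑[ q ∈ pairs m ] shared p q ≡ m + m
∑-shared {m} (i , j) = begin
  ∑[ q ∈ pairs m ] shared (i , j) q
    ≡⟨ ∑-product (allFin m) (allFin m) _ ⟩
  ∑[ i′ ∈ allFin m ] ∑[ j′ ∈ allFin m ] (e i′ + e′ j′)
    ≡⟨ ∑-cong (allFin m) (λ i′ → trans (∑-distrib-+ (allFin m) (λ _ → e i′) e′) (cong₂ _+_ (∑-allFin-const m (e i′)) (∑-allFin-≟ j))) ⟩
  ∑[ i′ ∈ allFin m ] (m * e i′ + 1)
    ≡⟨ ∑-distrib-+ (allFin m) _ _ ⟩
  (∑[ i′ ∈ allFin m ] m * e i′) + (∑[ _ ∈ allFin m ] 1)
    ≡⟨ cong₂ _+_ (trans (sym (∑-*ˡ (allFin m) m e)) (trans (cong (m *_) (∑-allFin-≟ i)) (*-identityʳ m)))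
                 (trans (∑-allFin-const m 1) (*-identityʳ m)) ⟩
  m + m ∎
  where
  open ≡-Reasoning
  e e′ : Fin m → ℕ
  e i′ = bit (does (i Fin.≟ i′))
  e′ j′ = bit (does (j Fin.≟ j′))

-- Counting over the random reserve points

module Reserve (d m : ℕ) where

  P = points d
  N = length P

  XY : List (Vec (Point d) m × Vec (Point d) m)
  XY = cartesianProduct (vecs P m) (vecs P m)

  T = length XY

  T≡ : T ≡ N ^ m * N ^ m
  T≡ = begin
    T                                              ≡⟨ length≡∑1 XY ⟩
    ∑[ _ ∈ XY ] 1                                  ≡⟨ ∑-product (vecs P m) (vecs P m) _ ⟩
    ∑[ _ ∈ vecs P m ] ∑[ _ ∈ vecs P m ] 1          ≡⟨ ∑-const (vecs P m) _ ⟩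
    length (vecs P m) * (∑[ _ ∈ vecs P m ] 1)      ≡⟨ cong (length (vecs P m) *_) (length≡∑1 (vecs P m)) ⟨
    length (vecs P m) * length (vecs P m)          ≡⟨ cong (λ n → n * n) (length-vecs P m) ⟩
    N ^ m * N ^ m                                  ∎
    where open ≡-Reasoning

  resampleˡ : ∀ i F → N * ∑ XY F ≡ ∑[ (x , y) ∈ XY ] ∑[ a ∈ P ] F (x [ i ]≔ a , y)
  resampleˡ i F = begin
    N * ∑ XY F                                                     ≡⟨ cong (N *_) (∑-product (vecs P m) (vecs P m) F) ⟩
    N * (∑[ x ∈ vecs P m ] ∑[ y ∈ vecs P m ] F (x , y))            ≡⟨ ∑-resample P i (λ x → ∑[ y ∈ vecs P m ] F (x , y)) ⟩
    ∑[ x ∈ vecs P m ] ∑[ a ∈ P ] ∑[ y ∈ vecs P m ] F (x [ i ]≔ a , y)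
      ≡⟨ ∑-cong (vecs P m) (λ x → ∑-swap P (vecs P m) (λ a y → F (x [ i ]≔ a , y))) ⟩
    ∑[ x ∈ vecs P m ] ∑[ y ∈ vecs P m ] ∑[ a ∈ P ] F (x [ i ]≔ a , y) ≡⟨ ∑-product (vecs P m) (vecs P m) _ ⟨
    ∑[ (x , y) ∈ XY ] ∑[ a ∈ P ] F (x [ i ]≔ a , y)                ∎
    where open ≡-Reasoning

  resampleʳ : ∀ j F → N * ∑ XY F ≡ ∑[ (x , y) ∈ XY ] ∑[ b ∈ P ] F (x , y [ j ]≔ b)
  resampleʳ j F = begin
    N * ∑ XY F                                                     ≡⟨ cong (N *_) (∑-product (vecs P m) (vecs P m) F) ⟩
    N * (∑[ x ∈ vecs P m ] ∑[ y ∈ vecs P m ] F (x , y))            ≡⟨ ∑-*ˡ (vecs P m) N _ ⟩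
    ∑[ x ∈ vecs P m ] N * (∑[ y ∈ vecs P m ] F (x , y))            ≡⟨ ∑-cong (vecs P m) (λ x → ∑-resample P j (λ y → F (x , y))) ⟩
    ∑[ x ∈ vecs P m ] ∑[ y ∈ vecs P m ] ∑[ b ∈ P ] F (x , y [ j ]≔ b) ≡⟨ ∑-product (vecs P m) (vecs P m) _ ⟨
    ∑[ (x , y) ∈ XY ] ∑[ b ∈ P ] F (x , y [ j ]≔ b)                ∎
    where open ≡-Reasoning

  resample : ∀ i j F → N * N * ∑ XY F ≡ ∑[ (x , y) ∈ XY ] ∑[ a ∈ P ] ∑[ b ∈ P ] F (x [ i ]≔ a , y [ j ]≔ b)
  resample i j F = begin
    N * N * ∑ XY F                                             ≡⟨ *-assoc N N _ ⟩
    N * (N * ∑ XY F)                                           ≡⟨ cong (N *_) (resampleʳ j F) ⟩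
    N * (∑[ (x , y) ∈ XY ] ∑[ b ∈ P ] F (x , y [ j ]≔ b))      ≡⟨ resampleˡ i (λ (x , y) → ∑[ b ∈ P ] F (x , y [ j ]≔ b)) ⟩
    ∑[ (x , y) ∈ XY ] ∑[ a ∈ P ] ∑[ b ∈ P ] F (x [ i ]≔ a , y [ j ]≔ b) ∎
    where open ≡-Reasoning

  ∑-XY-1 : ∑[ _ ∈ XY ] 1 ≡ T
  ∑-XY-1 = sym (length≡∑1 XY)

  -- Distinct pairs differ in a row or in a column. When the reserve point of `p` there is redrawn
  -- and all others are kept, the sum of `q` does not move, so only one value of the redrawn point
  -- makes the sums equal.
  collision : (p q : Fin m × Fin m) → N * (∑[ (x , y) ∈ XY ] bit (not (samePair p q)) * bit (does (sumAt x y p ≟ₚ sumAt x y q))) ≤ T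
  collision (i , j) (i′ , j′) with i Fin.≟ i′ | j Fin.≟ j′
  ... | yes _ | yes _ = ≤-trans (≤-reflexive (trans (cong (N *_) (∑-zero XY)) (*-zeroʳ N))) z≤n
  ... | no i≢i′ | _ = begin
    N * (∑[ (x , y) ∈ XY ] (bit (does (lookup x i ⊕ lookup y j ≟ₚ lookup x i′ ⊕ lookup y j′)) + 0))
      ≡⟨ resampleˡ i _ ⟩
    ∑[ (x , y) ∈ XY ] ∑[ a ∈ P ] (bit (does (lookup (x [ i ]≔ a) i ⊕ lookup y j ≟ₚ lookup (x [ i ]≔ a) i′ ⊕ lookup y j′)) + 0)
      ≤⟨ ∑-mono-≤ XY (λ (x , y) → ≤-trans
           (∑-mono-≤ P λ a → ≤-trans (≤-reflexive (+-identityʳ _))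
             (bit-≤ (_ ≟ₚ _) (a ≟ₚ lookup x i′ ⊕ lookup y j′ ⊕ lookup y j) λ eq →
               ⊕-cancel a (lookup y j) _ (subst₂ (λ u v → u ⊕ lookup y j ≡ v ⊕ lookup y j′)
                 (lookup∘update i x a) (lookup∘update′ (i≢i′ ∘ sym) x a) eq)))
           (≤-reflexive (∑-points-≟ (lookup x i′ ⊕ lookup y j′ ⊕ lookup y j)))) ⟩
    ∑[ _ ∈ XY ] 1
      ≡⟨ ∑-XY-1 ⟩
    T ∎
    where open ≤-Reasoning
  ... | yes _ | no j≢j′ = begin
    N * (∑[ (x , y) ∈ XY ] (bit (does (lookup x i ⊕ lookup y j ≟ₚ lookup x i′ ⊕ lookup y j′)) + 0))
      ≡⟨ resampleʳ j _ ⟩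
    ∑[ (x , y) ∈ XY ] ∑[ b ∈ P ] (bit (does (lookup x i ⊕ lookup (y [ j ]≔ b) j ≟ₚ lookup x i′ ⊕ lookup (y [ j ]≔ b) j′)) + 0)
      ≤⟨ ∑-mono-≤ XY (λ (x , y) → ≤-trans
           (∑-mono-≤ P λ b → ≤-trans (≤-reflexive (+-identityʳ _))
             (bit-≤ (_ ≟ₚ _) (b ≟ₚ lookup x i′ ⊕ lookup y j′ ⊕ lookup x i) λ eq →
               ⊕-cancel b (lookup x i) _ (trans (⊕-comm b (lookup x i)) (subst₂ (λ u v → lookup x i ⊕ u ≡ lookup x i′ ⊕ v)
                 (lookup∘update j y b) (lookup∘update′ (j≢j′ ∘ sym) y b) eq))))
           (≤-reflexive (∑-points-≟ (lookup x i′ ⊕ lookup y j′ ⊕ lookup x i)))) ⟩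
    ∑[ _ ∈ XY ] 1
      ≡⟨ ∑-XY-1 ⟩
    T ∎
    where open ≤-Reasoning

  ∑-collisions : N * (∑[ (x , y) ∈ XY ] collisions (pairs m) samePair (sumAt x y)) ≤ m * m * (m * m) * T
  ∑-collisions = begin
    N * (∑[ (x , y) ∈ XY ] ∑[ p ∈ pairs m ] ∑[ q ∈ pairs m ] c p q x y)
      ≡⟨ cong (N *_) (trans (∑-swap XY (pairs m) _) (∑-cong (pairs m) λ p → ∑-swap XY (pairs m) _)) ⟩
    N * (∑[ p ∈ pairs m ] ∑[ q ∈ pairs m ] ∑[ (x , y) ∈ XY ] c p q x y)
      ≡⟨ trans (∑-*ˡ (pairs m) N _) (∑-cong (pairs m) λ p → ∑-*ˡ (pairs m) N _) ⟩
    ∑[ p ∈ pairs m ] ∑[ q ∈ pairs m ] N * (∑[ (x , y) ∈ XY ] c p q x y)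
      ≤⟨ ∑-mono-≤ (pairs m) (λ p → ∑-mono-≤ (pairs m) λ q → collision p q) ⟩
    ∑[ p ∈ pairs m ] ∑[ q ∈ pairs m ] T
      ≡⟨ trans (∑-cong (pairs m) λ _ → ∑-pairs-const m T) (trans (∑-pairs-const m _) (sym (*-assoc (m * m) (m * m) T))) ⟩
    m * m * (m * m) * T ∎
    where
    open ≤-Reasoning
    c : ∀ p q (x y : Vec (Point d) m) → ℕ
    c p q x y = bit (not (samePair p q)) * bit (does (sumAt x y p ≟ₚ sumAt x y q))

  -- First and second moments of the number of violated reserve pairs

  module _ (f : Input d) where

    V = ∑[ a ∈ P ] ∑[ b ∈ P ] bit (violation f a b)

    ∑-violationAt : ∀ p → N * N * (∑[ (x , y) ∈ XY ] violationAt f x y p) ≡ T * V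
    ∑-violationAt (i , j) = begin
      N * N * (∑[ (x , y) ∈ XY ] violationAt f x y (i , j))
        ≡⟨ resample i j _ ⟩
      ∑[ (x , y) ∈ XY ] ∑[ a ∈ P ] ∑[ b ∈ P ] violationAt f (x [ i ]≔ a) (y [ j ]≔ b) (i , j)
        ≡⟨ ∑-cong XY (λ (x , y) → ∑-cong P λ a → ∑-cong P λ b →
             cong₂ (λ u v → bit (violation f u v)) (lookup∘update i x a) (lookup∘update j y b)) ⟩
      ∑[ _ ∈ XY ] V
        ≡⟨ ∑-const XY V ⟩
      T * V ∎
      where open ≡-Reasoning

    -- Redrawing the two points of the first pair leaves the second indicator alone, so the first
    -- averages to V/N² for every value of the second.
    ∑-violationAt-independent : ∀ {i j i′ j′} → i ≢ i′ → j ≢ j′ →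
      N * N * (N * N) * (∑[ (x , y) ∈ XY ] violationAt f x y (i , j) * violationAt f x y (i′ , j′)) ≡ T * (V * V)
    ∑-violationAt-independent {i} {j} {i′} {j′} i≢i′ j≢j′ = begin
      N * N * (N * N) * (∑[ (x , y) ∈ XY ] z x y * z′ x y)
        ≡⟨ *-assoc (N * N) (N * N) _ ⟩
      N * N * (N * N * (∑[ (x , y) ∈ XY ] z x y * z′ x y))
        ≡⟨ cong (N * N *_) (resample i j _) ⟩
      N * N * (∑[ (x , y) ∈ XY ] ∑[ a ∈ P ] ∑[ b ∈ P ] z (x [ i ]≔ a) (y [ j ]≔ b) * z′ (x [ i ]≔ a) (y [ j ]≔ b))
        ≡⟨ cong (N * N *_) (∑-cong XY λ (x , y) → ∑-cong P λ a → ∑-cong P λ b → cong₂ _*_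
             (cong₂ (λ u v → bit (violation f u v)) (lookup∘update i x a) (lookup∘update j y b))
             (cong₂ (λ u v → bit (violation f u v)) (lookup∘update′ (i≢i′ ∘ sym) x a) (lookup∘update′ (j≢j′ ∘ sym) y b))) ⟩
      N * N * (∑[ (x , y) ∈ XY ] ∑[ a ∈ P ] ∑[ b ∈ P ] bit (violation f a b) * z′ x y)
        ≡⟨ cong (N * N *_) (∑-cong XY λ (x , y) →
             trans (∑-cong P λ a → sym (∑-*ʳ P _ (z′ x y))) (sym (∑-*ʳ P _ (z′ x y)))) ⟩
      N * N * (∑[ (x , y) ∈ XY ] V * z′ x y)
        ≡⟨ cong (N * N *_) (∑-*ˡ XY V _) ⟨
      N * N * (V * (∑[ (x , y) ∈ XY ] z′ x y))
        ≡⟨ lemma (N * N) V _ ⟩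
      V * (N * N * (∑[ (x , y) ∈ XY ] z′ x y))
        ≡⟨ cong (V *_) (∑-violationAt (i′ , j′)) ⟩
      V * (T * V)
        ≡⟨ lemma V T V ⟩
      T * (V * V) ∎
      where
      open ≡-Reasoning
      z z′ : (x y : Vec (Point d) m) → ℕ
      z x y = violationAt f x y (i , j)
      z′ x y = violationAt f x y (i′ , j′)
      lemma : ∀ a b c → a * (b * c) ≡ b * (a * c)
      lemma = solve-∀

    ∑-violationAt-crude : ∀ p q →
      N * N * (N * N) * (∑[ (x , y) ∈ XY ] violationAt f x y p * violationAt f x y q) ≤ T * (N * N * V)
    ∑-violationAt-crude p q = begin
      N * N * (N * N) * (∑[ (x , y) ∈ XY ] violationAt f x y p * violationAt f x y q)
        ≤⟨ *-monoʳ-≤ (N * N * (N * N)) (∑-mono-≤ XY λ (x , y) →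
             ≤-trans (*-monoʳ-≤ (violationAt f x y p) (bit≤1 _)) (≤-reflexive (*-identityʳ _))) ⟩
      N * N * (N * N) * (∑[ (x , y) ∈ XY ] violationAt f x y p)
        ≡⟨ *-assoc (N * N) (N * N) _ ⟩
      N * N * (N * N * (∑[ (x , y) ∈ XY ] violationAt f x y p))
        ≡⟨ cong (N * N *_) (∑-violationAt p) ⟩
      N * N * (T * V)
        ≡⟨ lemma (N * N) T V ⟩
      T * (N * N * V) ∎
      where
      open ≤-Reasoning
      lemma : ∀ a b c → a * (b * c) ≡ b * (a * c)
      lemma = solve-∀

    -- Pairs with a common index may be correlated, and for them one indicator is simply dropped.
    -- Summed over all `p` and `q`, this costs only a 2/m fraction, because `shared` has row sums 2m
    -- out of m².
    ∑-violationAt² : ∀ p q →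
      N * N * (N * N) * (∑[ (x , y) ∈ XY ] violationAt f x y p * violationAt f x y q) ≤
      T * (V * V) + shared p q * (T * (N * N * V))
    ∑-violationAt² p@(i , j) q@(i′ , j′) with i Fin.≟ i′ | j Fin.≟ j′
    ... | no i≢i′ | no j≢j′ = ≤-trans (≤-reflexive (∑-violationAt-independent i≢i′ j≢j′)) (m≤m+n _ _)
    ... | yes _   | e       = ≤-trans (∑-violationAt-crude p q) (≤-trans (m≤m+n _ (bit (does e) * (T * (N * N * V)))) (m≤n+m _ (T * (V * V))))
    ... | no _    | yes _   = ≤-trans (∑-violationAt-crude p q) (≤-trans (m≤m+n _ 0) (m≤n+m _ (T * (V * V))))

    violations : Vec (Point d) m × Vec (Point d) m → ℕ
    violations (x , y) = ∑[ p ∈ pairs m ] violationAt f x y p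

    ∑-violations : N * N * ∑ XY violations ≡ m * m * (T * V)
    ∑-violations = begin
      N * N * (∑[ (x , y) ∈ XY ] ∑[ p ∈ pairs m ] violationAt f x y p)
        ≡⟨ cong (N * N *_) (∑-swap XY (pairs m) _) ⟩
      N * N * (∑[ p ∈ pairs m ] ∑[ (x , y) ∈ XY ] violationAt f x y p)
        ≡⟨ ∑-*ˡ (pairs m) (N * N) _ ⟩
      ∑[ p ∈ pairs m ] N * N * (∑[ (x , y) ∈ XY ] violationAt f x y p)
        ≡⟨ ∑-cong (pairs m) ∑-violationAt ⟩
      ∑[ p ∈ pairs m ] T * V
        ≡⟨ ∑-pairs-const m (T * V) ⟩
      m * m * (T * V) ∎
      where open ≡-Reasoning

    ∑-violations² : N * N * (N * N) * (∑[ v ∈ XY ] violations v * violations v) ≤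
      m * m * (m * m) * (T * (V * V)) + m * m * (m + m) * (T * (N * N * V))
    ∑-violations² = begin
      N⁴ * (∑[ v ∈ XY ] violations v * violations v)
        ≡⟨ cong (N⁴ *_) (∑-cong XY λ v → ∑-* (pairs m) (pairs m) _ _) ⟩
      N⁴ * (∑[ (x , y) ∈ XY ] ∑[ p ∈ pairs m ] ∑[ q ∈ pairs m ] violationAt f x y p * violationAt f x y q)
        ≡⟨ cong (N⁴ *_) (trans (∑-swap XY (pairs m) _) (∑-cong (pairs m) λ p → ∑-swap XY (pairs m) _)) ⟩
      N⁴ * (∑[ p ∈ pairs m ] ∑[ q ∈ pairs m ] ∑[ (x , y) ∈ XY ] violationAt f x y p * violationAt f x y q)
        ≡⟨ trans (∑-*ˡ (pairs m) N⁴ _) (∑-cong (pairs m) λ p → ∑-*ˡ (pairs m) N⁴ _) ⟩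
      ∑[ p ∈ pairs m ] ∑[ q ∈ pairs m ] N⁴ * (∑[ (x , y) ∈ XY ] violationAt f x y p * violationAt f x y q)
        ≤⟨ ∑-mono-≤ (pairs m) (λ p → ∑-mono-≤ (pairs m) (∑-violationAt² p)) ⟩
      ∑[ p ∈ pairs m ] ∑[ q ∈ pairs m ] (A₀ + shared p q * B₀)
        ≡⟨ ∑-cong (pairs m) (λ p → trans (∑-distrib-+ (pairs m) _ _) (cong₂ _+_ (∑-pairs-const m A₀)
             (trans (sym (∑-*ʳ (pairs m) (shared p) B₀)) (cong (_* B₀) (∑-shared p))))) ⟩
      ∑[ p ∈ pairs m ] (m * m * A₀ + (m + m) * B₀)
        ≡⟨ ∑-pairs-const m _ ⟩
      m * m * (m * m * A₀ + (m + m) * B₀)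
        ≡⟨ lemma (m * m) A₀ (m + m) B₀ ⟩
      m * m * (m * m) * A₀ + m * m * (m + m) * B₀ ∎
      where
      open ≤-Reasoning
      N⁴ = N * N * (N * N)
      A₀ = T * (V * V)
      B₀ = T * (N * N * V)
      lemma : ∀ m a c b → m * (m * a + c * b) ≡ m * m * a + m * c * b
      lemma = solve-∀

    -- The number of violated pairs among the `k` draws

    module _ (k : ℕ) where

      W = vecs (pairs m) k
      Q = (m * m) ^ k

      detections : Vec (Point d) m × Vec (Point d) m → Vec (Fin m × Fin m) k → ℕ
      detections (x , y) w = sumᵛ (violationAt f x y) w

      length-W : length W ≡ Q
      length-W = trans (length-vecs (pairs m) k) (cong (_^ k) (length-pairs m))

      ∑-detections : .{{_ : NonZero m}} →
        N * N * (∑[ v ∈ XY ] ∑[ w ∈ W ] detections v w) ≡ Q * T * (k * V)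
      ∑-detections = *-cancelˡ-≡ _ _ (m * m) {{m*n≢0 m m}} (begin
        m * m * (N * N * (∑[ v ∈ XY ] ∑[ w ∈ W ] detections v w))
          ≡⟨ lemma₁ (m * m) (N * N) _ ⟩
        N * N * (m * m * (∑[ v ∈ XY ] ∑[ w ∈ W ] detections v w))
          ≡⟨ cong (N * N *_) (∑-*ˡ XY (m * m) _) ⟩
        N * N * (∑[ v ∈ XY ] m * m * (∑[ w ∈ W ] detections v w))
          ≡⟨ cong (N * N *_) (∑-cong XY λ (x , y) →
               subst (λ ℓ → ℓ * (∑[ w ∈ W ] detections (x , y) w) ≡ ℓ ^ k * (k * violations (x , y)))
                     (length-pairs m) (∑-sumᵛ (pairs m) (violationAt f x y) k)) ⟩
        N * N * (∑[ v ∈ XY ] Q * (k * violations v))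
          ≡⟨ cong (N * N *_) (trans (∑-cong XY λ v → sym (*-assoc Q k (violations v))) (sym (∑-*ˡ XY (Q * k) violations))) ⟩
        N * N * (Q * k * ∑ XY violations)
          ≡⟨ lemma₁ (N * N) (Q * k) _ ⟩
        Q * k * (N * N * ∑ XY violations)
          ≡⟨ cong (Q * k *_) ∑-violations ⟩
        Q * k * (m * m * (T * V))
          ≡⟨ lemma₂ Q k (m * m) T V ⟩
        m * m * (Q * T * (k * V)) ∎)
        where
        open ≡-Reasoning
        lemma₁ : ∀ a b c → a * (b * c) ≡ b * (a * c)
        lemma₁ = solve-∀
        lemma₂ : ∀ Q k m T V → Q * k * (m * (T * V)) ≡ m * (Q * T * (k * V))
        lemma₂ = solve-∀

      -- With μ = kV/N² the mean number of violated draws Z, this reads E[Z²] ≤ μ² + μ(1 + 2k/m).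
      -- The term μ comes from the k draws given the reserve, and 2kμ/m from the dependence among
      -- pairs within the reserve.
      ∑-detections² : .{{_ : NonZero m}} →
        m * (N * N * (N * N) * (∑[ v ∈ XY ] ∑[ w ∈ W ] detections v w * detections v w)) ≤
        m * (Q * T * (k * V * (k * V))) + k * V * (Q * T * (N * N * (m + 2 * k)))
      ∑-detections² = *-cancelˡ-≤ (m * m * m) {{m*n≢0 (m * m) m {{m*n≢0 m m}}}} (begin
        m * m * m * (m * (N⁴ * (∑[ v ∈ XY ] ∑[ w ∈ W ] Z² v w)))
          ≡⟨ lemma₁ m N⁴ _ ⟩
        N⁴ * (m * m * (m * m) * (∑[ v ∈ XY ] ∑[ w ∈ W ] Z² v w))
          ≡⟨ cong (N⁴ *_) (∑-*ˡ XY (m * m * (m * m)) _) ⟩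
        N⁴ * (∑[ v ∈ XY ] m * m * (m * m) * (∑[ w ∈ W ] Z² v w))
          ≤⟨ *-monoʳ-≤ N⁴ (∑-mono-≤ XY λ (x , y) →
               subst (λ ℓ → ℓ * ℓ * (∑[ w ∈ W ] Z² (x , y) w) ≤ ℓ ^ k * (k * (ℓ * violations (x , y)) + k * k * (violations (x , y) * violations (x , y))))
                     (length-pairs m) (∑-sumᵛ² (pairs m) (violationAt f x y)
                       (λ p → ≤-trans (*-monoʳ-≤ (violationAt f x y p) (bit≤1 _)) (≤-reflexive (*-identityʳ _))) k)) ⟩
        N⁴ * (∑[ v ∈ XY ] Q * (k * (m * m * violations v) + k * k * (violations v * violations v)))
          ≡⟨ cong (N⁴ *_) (trans (sym (∑-*ˡ XY Q _)) (cong (Q *_) (trans (∑-distrib-+ XY _ _) (cong₂ _+_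
               (trans (∑-cong XY λ v → sym (*-assoc k (m * m) (violations v))) (sym (∑-*ˡ XY (k * (m * m)) violations)))
               (sym (∑-*ˡ XY (k * k) _)))))) ⟩
        N⁴ * (Q * (k * (m * m) * ∑ XY violations + k * k * (∑[ v ∈ XY ] violations v * violations v)))
          ≡⟨ lemma₂ (N * N) Q k (m * m) _ _ ⟩
        Q * (k * (m * m) * (N * N) * (N * N * ∑ XY violations) + k * k * (N⁴ * (∑[ v ∈ XY ] violations v * violations v)))
          ≤⟨ *-monoʳ-≤ Q (+-mono-≤ (≤-reflexive (cong (k * (m * m) * (N * N) *_) ∑-violations)) (*-monoʳ-≤ (k * k) ∑-violations²)) ⟩
        Q * (k * (m * m) * (N * N) * (m * m * (T * V)) +
             k * k * (m * m * (m * m) * (T * (V * V)) + m * m * (m + m) * (T * (N * N * V))))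
          ≡⟨ lemma₃ Q k m (N * N) T V ⟩
        m * m * m * (m * (Q * T * (k * V * (k * V))) + k * V * (Q * T * (N * N * (m + 2 * k)))) ∎)
        where
        open ≤-Reasoning
        N⁴ = N * N * (N * N)
        Z² : _ → _ → ℕ
        Z² v w = detections v w * detections v w
        lemma₁ : ∀ m n s → m * m * m * (m * (n * s)) ≡ n * (m * m * (m * m) * s)
        lemma₁ = solve-∀
        lemma₂ : ∀ n Q k m s s′ → n * n * (Q * (k * m * s + k * k * s′)) ≡ Q * (k * m * n * (n * s) + k * k * (n * n * s′))
        lemma₂ = solve-∀
        lemma₃ : ∀ Q k m n T V →
          Q * (k * (m * m) * n * (m * m * (T * V)) + k * k * (m * m * (m * m) * (T * (V * V)) + m * m * (m + m) * (T * (n * V)))) ≡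
          m * m * m * (m * (Q * T * (k * V * (k * V))) + k * V * (Q * T * (n * (m + 2 * k))))
        lemma₃ = solve-∀

      undetected = ∑[ v ∈ XY ] ∑[ w ∈ W ] bit (does (detections v w ≟ 0))

      -- Chebyshev's inequality in the form Pr[Z = 0] ≤ (1 + 2k/m)/μ. With a = kV, it sums the
      -- pointwise bound [Z = 0]·a² ≤ (N²Z - a)², whose mixed term is moved to the left to avoid
      -- subtraction.
      undetected-bound : .{{_ : NonZero m}} .{{_ : NonZero (k * V)}} →
        m * (k * V) * undetected ≤ Q * T * (N * N * (m + 2 * k))
      -- The target is multiplied by `a`, and `m * (Q * T * (a * a))` is added twice: once for the
      -- constant term of the pointwise bound and once for the squared mean in `∑-detections²`.
      undetected-bound = *-cancelˡ-≤ a (+-cancelˡ-≤ (m * (Q * T * (a * a))) _ _ (+-cancelˡ-≤ (m * (Q * T * (a * a))) _ _ (begin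
        m * (Q * T * (a * a)) + (m * (Q * T * (a * a)) + a * (m * a * undetected))
          ≡⟨ lemma₁ m (Q * T) a undetected ⟩
        m * (undetected * (a * a) + 2 * a * (Q * T * a))
          ≡⟨ cong (λ s → m * (undetected * (a * a) + 2 * a * s)) ∑-detections ⟨
        m * (undetected * (a * a) + 2 * a * (N * N * (∑[ v ∈ XY ] ∑[ w ∈ W ] detections v w)))
          ≡⟨ cong (m *_) expand ⟨
        m * (∑[ v ∈ XY ] ∑[ w ∈ W ] (bit (does (detections v w ≟ 0)) * (a * a) + 2 * a * (N * N * detections v w)))
          ≤⟨ *-monoʳ-≤ m (∑-mono-≤ XY λ v → ∑-mono-≤ W λ w → pointwise (detections v w)) ⟩
        m * (∑[ v ∈ XY ] ∑[ w ∈ W ] (N * N * (N * N) * (detections v w * detections v w) + a * a))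
          ≡⟨ cong (m *_) expand′ ⟩
        m * (N * N * (N * N) * (∑[ v ∈ XY ] ∑[ w ∈ W ] detections v w * detections v w) + Q * T * (a * a))
          ≡⟨ *-distribˡ-+ m _ _ ⟩
        m * (N * N * (N * N) * (∑[ v ∈ XY ] ∑[ w ∈ W ] detections v w * detections v w)) + m * (Q * T * (a * a))
          ≤⟨ +-monoˡ-≤ _ ∑-detections² ⟩
        m * (Q * T * (a * a)) + a * (Q * T * (N * N * (m + 2 * k))) + m * (Q * T * (a * a))
          ≡⟨ +-comm _ (m * (Q * T * (a * a))) ⟩
        m * (Q * T * (a * a)) + (m * (Q * T * (a * a)) + a * (Q * T * (N * N * (m + 2 * k)))) ∎)))
        where
        open ≤-Reasoning
        a = k * V
        lemma₁ : ∀ m q a u → m * (q * (a * a)) + (m * (q * (a * a)) + a * (m * a * u)) ≡ m * (u * (a * a) + 2 * a * (q * a))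
        lemma₁ = solve-∀
        expand : ∑[ v ∈ XY ] ∑[ w ∈ W ] (bit (does (detections v w ≟ 0)) * (a * a) + 2 * a * (N * N * detections v w)) ≡
                 undetected * (a * a) + 2 * a * (N * N * (∑[ v ∈ XY ] ∑[ w ∈ W ] detections v w))
        expand = trans (∑-cong XY λ v → ∑-distrib-+ W _ _) (trans (∑-distrib-+ XY _ _) (cong₂ _+_
          (trans (∑-cong XY λ v → sym (∑-*ʳ W _ (a * a))) (sym (∑-*ʳ XY _ (a * a))))
          (trans (∑-cong XY λ v → trans (sym (∑-*ˡ W (2 * a) _)) (cong (2 * a *_) (sym (∑-*ˡ W (N * N) _))))
            (trans (sym (∑-*ˡ XY (2 * a) _)) (cong (2 * a *_) (sym (∑-*ˡ XY (N * N) _)))))))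
        expand′ : ∑[ v ∈ XY ] ∑[ w ∈ W ] (N * N * (N * N) * (detections v w * detections v w) + a * a) ≡
                  N * N * (N * N) * (∑[ v ∈ XY ] ∑[ w ∈ W ] detections v w * detections v w) + Q * T * (a * a)
        expand′ = trans (∑-cong XY λ v → ∑-distrib-+ W _ _) (trans (∑-distrib-+ XY _ _) (cong₂ _+_
          (trans (∑-cong XY λ v → sym (∑-*ˡ W (N * N * (N * N)) _)) (sym (∑-*ˡ XY (N * N * (N * N)) _)))
          (trans (∑-cong XY λ v → trans (∑-const W (a * a)) (cong (_* (a * a)) length-W))
            (trans (∑-const XY _) (lemma T Q (a * a))))))
          where
          lemma : ∀ t q a → t * (q * a) ≡ q * t * a
          lemma = solve-∀
        pointwise : ∀ z → bit (does (z ≟ 0)) * (a * a) + 2 * a * (N * N * z) ≤ N * N * (N * N) * (z * z) + a * a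
        pointwise zero    = ≤-trans (≤-reflexive (lemma a (N * N))) (m≤n+m (a * a) _)
          where
          lemma : ∀ a n → 1 * (a * a) + 2 * a * (n * 0) ≡ a * a
          lemma = solve-∀
        pointwise (suc z) = ≤-trans (am-gm a (N * N * suc z)) (≤-reflexive (lemma (N * N) (suc z) (a * a)))
          where
          lemma : ∀ n z a → n * z * (n * z) + a ≡ n * n * (z * z) + a
          lemma = solve-∀

-- Counting accepting outcomes against a fixed strategy

module Acceptance {d t : ℕ} (m k : ℕ) (S : Strategy d t) (f : Input d) where

  open Reserve d m hiding (V; W; Q; length-W; undetected; undetected-bound)
  V = Reserve.V d m f
  W = Reserve.W d m f k
  Q = Reserve.Q d m f k
  U = Reserve.undetected d m f k

  σ₀ : State S f
  σ₀ = [] , []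

  σ₁ σ₂ : Vec (Point d) m × Vec (Point d) m → State S f
  σ₁ (x , y) = steps S f σ₀ x
  σ₂ (x , y) = steps S f (σ₁ (x , y)) y

  hits₁ hits₂ : Vec (Point d) m × Vec (Point d) m → ℕ
  hits₁ (x , y) = hits S f σ₀ x
  hits₂ (x , y) = hits S f (σ₁ (x , y)) y

  hits₃ : Vec (Point d) m × Vec (Point d) m → Vec (Fin m × Fin m) k → ℕ
  hits₃ (x , y) w = hits S f (σ₂ (x , y)) (Vec.map (sumAt x y) w)

  length-σ₁ : ∀ v → length (proj₁ (σ₁ v)) ≤ t * m
  length-σ₁ (x , y) = length-steps S f σ₀ x

  length-σ₂ : ∀ v → length (proj₁ (σ₂ v)) ≤ t * m + t * m
  length-σ₂ (x , y) = ≤-trans (length-steps S f (σ₁ (x , y)) y) (+-monoˡ-≤ (t * m) (length-σ₁ (x , y)))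

  ∑-hits-uniform : ∀ σ → N * (∑[ x ∈ vecs P m ] hits S f σ x) ≤ N ^ m * (m * (length (proj₁ σ) + t * m))
  ∑-hits-uniform σ = begin
    N * (∑[ x ∈ vecs P m ] hits S f σ x)                ≡⟨ cong (N *_) (∑-cong (vecs P m) λ x → cong (hits S f σ) (map-id x)) ⟨
    N * (∑[ x ∈ vecs P m ] hits S f σ (Vec.map id x))   ≤⟨ ∑-hits S f P id 1 (λ z → ≤-reflexive (∑-points-≟ z)) m σ ⟩
    N ^ m * (1 * (m * (length (proj₁ σ) + t * m)))      ≡⟨ cong (N ^ m *_) (*-identityˡ _) ⟩
    N ^ m * (m * (length (proj₁ σ) + t * m))            ∎
    where open ≤-Reasoning

  ∑-hits₁ : N * ∑ XY hits₁ ≤ T * (m * (t * m))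
  ∑-hits₁ = begin
    N * ∑ XY hits₁
      ≡⟨ cong (N *_) (∑-product (vecs P m) (vecs P m) _) ⟩
    N * (∑[ x ∈ vecs P m ] ∑[ _ ∈ vecs P m ] hits S f σ₀ x)
      ≡⟨ cong (N *_) (∑-cong (vecs P m) λ x → trans (∑-const (vecs P m) _) (cong (_* hits S f σ₀ x) (length-vecs P m))) ⟩
    N * (∑[ x ∈ vecs P m ] N ^ m * hits S f σ₀ x)
      ≡⟨ cong (N *_) (∑-*ˡ (vecs P m) (N ^ m) _) ⟨
    N * (N ^ m * (∑[ x ∈ vecs P m ] hits S f σ₀ x))
      ≡⟨ lemma N (N ^ m) _ ⟩
    N ^ m * (N * (∑[ x ∈ vecs P m ] hits S f σ₀ x))
      ≤⟨ *-monoʳ-≤ (N ^ m) (∑-hits-uniform σ₀) ⟩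
    N ^ m * (N ^ m * (m * (t * m)))
      ≡⟨ *-assoc (N ^ m) (N ^ m) _ ⟨
    N ^ m * N ^ m * (m * (t * m))
      ≡⟨ cong (_* (m * (t * m))) T≡ ⟨
    T * (m * (t * m)) ∎
    where
    open ≤-Reasoning
    lemma : ∀ a b c → a * (b * c) ≡ b * (a * c)
    lemma = solve-∀

  ∑-hits₂ : N * ∑ XY hits₂ ≤ T * (m * (t * m + t * m))
  ∑-hits₂ = begin
    N * ∑ XY hits₂
      ≡⟨ cong (N *_) (∑-product (vecs P m) (vecs P m) _) ⟩
    N * (∑[ x ∈ vecs P m ] ∑[ y ∈ vecs P m ] hits S f (steps S f σ₀ x) y)
      ≡⟨ ∑-*ˡ (vecs P m) N _ ⟩
    ∑[ x ∈ vecs P m ] N * (∑[ y ∈ vecs P m ] hits S f (steps S f σ₀ x) y)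
      ≤⟨ ∑-mono-≤ (vecs P m) (λ x → ≤-trans (∑-hits-uniform (steps S f σ₀ x))
           (*-monoʳ-≤ (N ^ m) (*-monoʳ-≤ m (+-monoˡ-≤ (t * m) (length-steps S f σ₀ x))))) ⟩
    ∑[ x ∈ vecs P m ] N ^ m * (m * (t * m + t * m))
      ≡⟨ trans (∑-const (vecs P m) _) (cong (_* (N ^ m * (m * (t * m + t * m)))) (length-vecs P m)) ⟩
    N ^ m * (N ^ m * (m * (t * m + t * m)))
      ≡⟨ *-assoc (N ^ m) (N ^ m) _ ⟨
    N ^ m * N ^ m * (m * (t * m + t * m))
      ≡⟨ cong (_* (m * (t * m + t * m))) T≡ ⟨
    T * (m * (t * m + t * m)) ∎
    where open ≤-Reasoning

  allCollisions : ℕ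
  allCollisions = ∑[ (x , y) ∈ XY ] collisions (pairs m) samePair (sumAt x y)

  -- The reserve is fixed before the pairs are drawn. At most 2tm + tk points are erased by the end,
  -- and each of them spoils at most 1 + `collisions` of the m² pairs, so averaging over reserves
  -- needs only the mean number of collisions.
  ∑-hits₃ : m * m * (∑[ v ∈ XY ] ∑[ w ∈ W ] hits₃ v w) ≤ Q * (k * (t * m + t * m + t * k)) * (T + allCollisions)
  ∑-hits₃ = begin
    m * m * (∑[ v ∈ XY ] ∑[ w ∈ W ] hits₃ v w)
      ≡⟨ ∑-*ˡ XY (m * m) _ ⟩
    ∑[ v ∈ XY ] m * m * (∑[ w ∈ W ] hits₃ v w)
      ≤⟨ ∑-mono-≤ XY perReserve ⟩
    ∑[ (x , y) ∈ XY ] c * (1 + collisions (pairs m) samePair (sumAt x y))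
      ≡⟨ ∑-*ˡ XY c _ ⟨
    c * (∑[ (x , y) ∈ XY ] (1 + collisions (pairs m) samePair (sumAt x y)))
      ≡⟨ cong (c *_) (trans (∑-distrib-+ XY _ _) (cong (_+ allCollisions) ∑-XY-1)) ⟩
    c * (T + allCollisions) ∎
    where
    open ≤-Reasoning
    c = Q * (k * (t * m + t * m + t * k))
    perReserve : ∀ v → m * m * (∑[ w ∈ W ] hits₃ v w) ≤ c * (1 + collisions (pairs m) samePair (sumAt (proj₁ v) (proj₂ v)))
    perReserve v@(x , y) = begin
      m * m * (∑[ w ∈ W ] hits₃ v w)
        ≤⟨ subst (λ ℓ → ℓ * (∑[ w ∈ W ] hits₃ v w) ≤ ℓ ^ k * (M * (k * (length (proj₁ (σ₂ v)) + t * k))))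
             (length-pairs m) (∑-hits S f (pairs m) (sumAt x y) M (multiplicity≤ (pairs m) samePair (sumAt x y) ∑-samePair) k (σ₂ v)) ⟩
      Q * (M * (k * (length (proj₁ (σ₂ v)) + t * k)))
        ≤⟨ *-monoʳ-≤ Q (*-monoʳ-≤ M (*-monoʳ-≤ k (+-monoˡ-≤ (t * k) (length-σ₂ v)))) ⟩
      Q * (M * (k * (t * m + t * m + t * k)))
        ≡⟨ lemma Q M _ ⟩
      c * M ∎
      where
      M = 1 + collisions (pairs m) samePair (sumAt x y)
      lemma : ∀ Q M r → Q * (M * r) ≡ Q * r * M
      lemma = solve-∀

  accepted : ℕ
  accepted = ∑[ (x , y) ∈ XY ] ∑[ w ∈ W ] bit (does (outcome S f (test x y w) Bool.≟ true))

  H₁₂ = Q * (∑ XY hits₁ + ∑ XY hits₂)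
  H₃ = ∑[ v ∈ XY ] ∑[ w ∈ W ] hits₃ v w

  accepted≤ : accepted ≤ H₁₂ + H₃ + U
  accepted≤ = begin
    accepted
      ≤⟨ ∑-mono-≤ XY (λ (x , y) → ∑-mono-≤ W (acceptance≤ S f x y)) ⟩
    ∑[ v ∈ XY ] ∑[ w ∈ W ] (hits₁ v + (hits₂ v + hits₃ v w) + u v w)
      ≡⟨ ∑-cong XY (λ v → ∑-cong W λ w → cong (_+ u v w) (sym (+-assoc (hits₁ v) (hits₂ v) (hits₃ v w)))) ⟩
    ∑[ v ∈ XY ] ∑[ w ∈ W ] (hits₁ v + hits₂ v + hits₃ v w + u v w)
      ≡⟨ trans (∑-cong XY λ v → ∑-distrib-+ W _ _) (∑-distrib-+ XY _ _) ⟩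
    (∑[ v ∈ XY ] ∑[ w ∈ W ] (hits₁ v + hits₂ v + hits₃ v w)) + U
      ≡⟨ cong (_+ U) (trans (∑-cong XY λ v → ∑-distrib-+ W _ _) (∑-distrib-+ XY _ _)) ⟩
    (∑[ v ∈ XY ] ∑[ w ∈ W ] (hits₁ v + hits₂ v)) + H₃ + U
      ≡⟨ cong (λ s → s + H₃ + U) (trans (∑-cong XY λ v → trans (∑-const W _) (cong (_* (hits₁ v + hits₂ v)) (Reserve.length-W d m f k)))
           (trans (sym (∑-*ˡ XY Q _)) (cong (Q *_) (∑-distrib-+ XY hits₁ hits₂)))) ⟩
    H₁₂ + H₃ + U ∎
    where
    open ≤-Reasoning
    u : _ → _ → ℕ
    u v w = bit (does (Reserve.detections d m f k v w ≟ 0))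

open Acceptance hiding (W; Q)

-- Each of the three terms of accepted≤ is at most a ninth of the sample space.
module _ {d t : ℕ} {{_ : NonZero t}} (u : ℕ) {{_ : NonZero u}} (S : Strategy d t) (f : Input d) where

  private
    -- Violated pairs will have density at least 1/(2u), so 24u draws contain 12 of them on average,
    -- and Chebyshev leaves (1 + 2K/M)/12 ≤ 19/216.
    K = 24 * u
    -- As K ≤ M, fewer than or exactly 3tM points are erased. Without collisions, K draws from M²
    -- pairs meet them with probability at most 3tK/M = 1/12; the expected collisions, at most 1/16,
    -- raise this to 17/192.
    M = 36 * (t * K)
    N = 2 ^ d
    T = Reserve.T d M
    Q = (M * M) ^ K
    R = Q * T

  1≤k : 1 ≤ K
  1≤k = ≤-trans (>-nonZero⁻¹ u) (m≤n*m u 24)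

  k≤m : K ≤ M
  k≤m = ≤-trans (m≤n*m K t) (m≤n*m (t * K) 36)

  3t≤m : 3 * t ≤ M
  3t≤m = *-mono-≤ {3} {36} (s≤s (s≤s (s≤s z≤n))) (m≤m*n t K {{>-nonZero 1≤k}})

  1≤m : 1 ≤ M
  1≤m = ≤-trans 1≤k k≤m

  instance
    m≢0 : NonZero M
    m≢0 = >-nonZero 1≤m

    N≢0 : NonZero N
    N≢0 = m^n≢0 2 d

  module _ (dense : 16 * (M * M * (M * M)) ≤ N) where

    -- Erased reserve points occur with probability at most 3tM²/N. This is below M⁴/N, so the
    -- density hypothesis that controls collisions pays for them too.
    H₁₂-bound : 16 * H₁₂ M K S f ≤ R
    H₁₂-bound = *-cancelˡ-≤ N (begin
      N * (16 * (Q * (h₁ + h₂)))                               ≡⟨ lemma₁ N Q h₁ h₂ ⟩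
      16 * (Q * (N * h₁ + N * h₂))                             ≤⟨ *-monoʳ-≤ 16 (*-monoʳ-≤ Q (+-mono-≤
                                                                    (subst (λ n → n * h₁ ≤ T * (M * (t * M))) (length-points d) (∑-hits₁ M K S f))
                                                                    (subst (λ n → n * h₂ ≤ T * (M * (t * M + t * M))) (length-points d) (∑-hits₂ M K S f)))) ⟩
      16 * (Q * (T * (M * (t * M)) + T * (M * (t * M + t * M)))) ≡⟨ lemma₂ Q T M t ⟩
      R * (16 * (M * M * (3 * t)))                             ≤⟨ *-monoʳ-≤ R (*-monoʳ-≤ 16 (*-monoʳ-≤ (M * M) (≤-trans 3t≤m (m≤m*n M M)))) ⟩
      R * (16 * (M * M * (M * M)))                             ≤⟨ *-monoʳ-≤ R dense ⟩
      R * N                                                    ≡⟨ *-comm R N ⟩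
      N * R                                                    ∎)
      where
      open ≤-Reasoning
      h₁ = ∑ (Reserve.XY d M) (hits₁ M K S f)
      h₂ = ∑ (Reserve.XY d M) (hits₂ M K S f)
      lemma₁ : ∀ N Q h h′ → N * (16 * (Q * (h + h′))) ≡ 16 * (Q * (N * h + N * h′))
      lemma₁ = solve-∀
      lemma₂ : ∀ Q T m t → 16 * (Q * (T * (m * (t * m)) + T * (m * (t * m + t * m)))) ≡ Q * T * (16 * (m * m * (3 * t)))
      lemma₂ = solve-∀

    collisions-bound : 16 * allCollisions M K S f ≤ T
    collisions-bound = *-cancelˡ-≤ N (begin
      N * (16 * c)                     ≡⟨ lemma N c ⟩
      16 * (N * c)                     ≤⟨ *-monoʳ-≤ 16 (subst (λ n → n * c ≤ M * M * (M * M) * T) (length-points d) (Reserve.∑-collisions d M)) ⟩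
      16 * (M * M * (M * M) * T)       ≡⟨ *-assoc 16 (M * M * (M * M)) T ⟨
      16 * (M * M * (M * M)) * T       ≤⟨ *-monoˡ-≤ T dense ⟩
      N * T                            ∎)
      where
      open ≤-Reasoning
      c = allCollisions M K S f
      lemma : ∀ n c → n * (16 * c) ≡ 16 * (n * c)
      lemma = solve-∀

    H₃-bound : 192 * H₃ M K S f ≤ 17 * R
    H₃-bound = *-cancelˡ-≤ (M * M) {{m*n≢0 M M}} (begin
      M * M * (192 * h)                                            ≡⟨ lemma₁ (M * M) h ⟩
      192 * (M * M * h)                                            ≤⟨ *-monoʳ-≤ 192 (∑-hits₃ M K S f) ⟩
      192 * (Q * (K * (t * M + t * M + t * K)) * (T + c))          ≤⟨ *-monoʳ-≤ 192 (*-monoˡ-≤ (T + c) (*-monoʳ-≤ Q (*-monoʳ-≤ K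
                                                                        (+-monoʳ-≤ (t * M + t * M) (*-monoʳ-≤ t k≤m))))) ⟩
      192 * (Q * (K * (t * M + t * M + t * M)) * (T + c))          ≡⟨ lemma₂ Q K t M T c ⟩
      36 * (t * K) * M * (Q * (16 * T + 16 * c))                   ≤⟨ *-monoʳ-≤ (M * M) (*-monoʳ-≤ Q (+-monoʳ-≤ (16 * T) collisions-bound)) ⟩
      M * M * (Q * (16 * T + T))                                   ≡⟨ cong (M * M *_) (lemma₃ Q T) ⟩
      M * M * (17 * R)                                             ∎)
      where
      open ≤-Reasoning
      h = H₃ M K S f
      c = allCollisions M K S f
      lemma₁ : ∀ m h → m * (192 * h) ≡ 192 * (m * h)
      lemma₁ = solve-∀
      lemma₂ : ∀ Q k t m T c → 192 * (Q * (k * (t * m + t * m + t * m)) * (T + c)) ≡ 36 * (t * k) * m * (Q * (16 * T + 16 * c))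
      lemma₂ = solve-∀
      lemma₃ : ∀ Q T → Q * (16 * T + T) ≡ 17 * (Q * T)
      lemma₃ = solve-∀

    module _ (blr : N * N ≤ 2 * u * V M K S f) where

      1≤V : 1 ≤ V M K S f
      1≤V with V M K S f | ≤-trans (>-nonZero⁻¹ (N * N) {{m*n≢0 N N}}) blr
      ... | zero  | le = ≤-trans le (≤-reflexive (*-zeroʳ (2 * u)))
      ... | suc _ | _  = s≤s z≤n

      U-bound : 216 * U M K S f ≤ 19 * R
      U-bound = *-cancelˡ-≤ (M * (K * v)) {{m*n≢0 M (K * v)}} (begin
        M * (K * v) * (216 * x)                    ≡⟨ lemma₁ (M * (K * v)) x ⟩
        216 * (M * (K * v) * x)                    ≤⟨ *-monoʳ-≤ 216 (Reserve.undetected-bound d M f K) ⟩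
        216 * (Q * T * (n′ * n′ * (M + 2 * K)))    ≡⟨ cong (λ n → 216 * (Q * T * (n * n * (M + 2 * K)))) {n′} {N} (length-points d) ⟩
        216 * (Q * T * (N * N * (M + 2 * K)))      ≤⟨ *-monoʳ-≤ 216 (*-monoʳ-≤ R (*-monoˡ-≤ (M + 2 * K) blr)) ⟩
        216 * (R * (2 * u * v * (M + 2 * K)))      ≡⟨ lemma₂ R u v M K ⟩
        24 * u * v * R * (18 * M + 36 * K)         ≤⟨ *-monoʳ-≤ (24 * u * v * R) (+-monoʳ-≤ (18 * M) (*-monoʳ-≤ 36 (m≤n*m K t))) ⟩
        24 * u * v * R * (18 * M + M)              ≡⟨ lemma₃ (24 * u) v R M ⟩
        M * (K * v) * (19 * R)                     ∎)
        where
        open ≤-Reasoning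
        v = V M K S f
        x = U M K S f
        n′ = Reserve.N d M
        instance
          kv≢0 : NonZero (K * v)
          kv≢0 = m*n≢0 K v {{>-nonZero 1≤k}} {{>-nonZero 1≤V}}
        lemma₁ : ∀ a x → a * (216 * x) ≡ 216 * (a * x)
        lemma₁ = solve-∀
        lemma₂ : ∀ R u v m k → 216 * (R * (2 * u * v * (m + 2 * k))) ≡ 24 * u * v * R * (18 * m + 36 * k)
        lemma₂ = solve-∀
        lemma₃ : ∀ k v R m → k * v * R * (18 * m + m) ≡ m * (k * v) * (19 * R)
        lemma₃ = solve-∀

      acceptance-bound : 3 * accepted M K S f ≤ R
      acceptance-bound = *-cancelˡ-≤ 3 (begin
        3 * (3 * accepted M K S f)                     ≤⟨ *-monoʳ-≤ 3 (*-monoʳ-≤ 3 (accepted≤ M K S f)) ⟩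
        3 * (3 * (a + b + c))                          ≡⟨ lemma a b c ⟩
        9 * a + 9 * b + 9 * c                          ≤⟨ +-mono-≤ (+-mono-≤ a≤ b≤) c≤ ⟩
        R + R + R                                      ≡⟨ lemma′ R ⟩
        3 * R                                          ∎)
        where
        open ≤-Reasoning
        a = H₁₂ M K S f
        b = H₃ M K S f
        c = U M K S f
        lemma : ∀ a b c → 3 * (3 * (a + b + c)) ≡ 9 * a + 9 * b + 9 * c
        lemma = solve-∀
        lemma′ : ∀ r → r + r + r ≡ 3 * r
        lemma′ = solve-∀
        a≤ : 9 * a ≤ R
        a≤ = ≤-trans (*-monoˡ-≤ a (m≤m+n 9 7)) H₁₂-bound
        b≤ : 9 * b ≤ R
        b≤ = *-cancelˡ-≤ 17 (≤-trans (≤-reflexive (sym (*-assoc 17 9 b))) (≤-trans (*-monoˡ-≤ b (m≤m+n 153 39)) H₃-bound))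
        c≤ : 9 * c ≤ R
        c≤ = *-cancelˡ-≤ 19 (≤-trans (≤-reflexive (sym (*-assoc 19 9 c))) (≤-trans (*-monoˡ-≤ c (m≤m+n 171 45)) U-bound))

-- Fractions

/-mono-≤ : ∀ p q r s .{{_ : NonZero q}} .{{_ : NonZero s}} → p * s ≤ r * q → + p / q ≤ℚ + r / s
/-mono-≤ p (suc q) r (suc s) le = ℚ.toℚᵘ-cancel-≤
  (ℚᵘ.≤-trans (ℚᵘ.≤-reflexive (ℚ.toℚᵘ-fromℚᵘ (mkℚᵘ (+ p) q)))
  (ℚᵘ.≤-trans (*≤*ᵘ (subst₂ _≤ᶻ_ (ℤ.pos-* p (suc s)) (ℤ.pos-* r (suc q)) (+≤+ le)))
              (ℚᵘ.≤-reflexive (ℚᵘ.≃-sym (ℚ.toℚᵘ-fromℚᵘ (mkℚᵘ (+ r) s))))))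

/-cancel-≤ : ∀ p q r s .{{_ : NonZero q}} .{{_ : NonZero s}} → + p / q ≤ℚ + r / s → p * s ≤ r * q
/-cancel-≤ p (suc q) r (suc s) le = ℤ.drop‿+≤+ (subst₂ _≤ᶻ_ (sym (ℤ.pos-* p (suc s))) (sym (ℤ.pos-* r (suc q)))
  (ℚᵘ.drop-*≤* (ℚᵘ.≤-trans (ℚᵘ.≤-reflexive (ℚᵘ.≃-sym (ℚ.toℚᵘ-fromℚᵘ (mkℚᵘ (+ p) q))))
  (ℚᵘ.≤-trans (ℚ.toℚᵘ-mono-≤ le) (ℚᵘ.≤-reflexive (ℚ.toℚᵘ-fromℚᵘ (mkℚᵘ (+ r) s)))))))

/-* : ∀ p q r s .{{_ : NonZero q}} .{{_ : NonZero s}} →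
      (+ p / q) *ℚ (+ r / s) ≡ _/_ (+ (p * r)) (q * s) {{m*n≢0 q s}}
/-* p (suc q) r (suc s) = ℚ.toℚᵘ-injective
  (ℚᵘ.≃-trans (ℚ.toℚᵘ-homo-* (+ p / suc q) (+ r / suc s))
  (ℚᵘ.≃-trans (ℚᵘ.*-cong (ℚ.toℚᵘ-fromℚᵘ (mkℚᵘ (+ p) q)) (ℚ.toℚᵘ-fromℚᵘ (mkℚᵘ (+ r) s)))
  (ℚᵘ.≃-trans (ℚᵘ.≃-reflexive (cong (λ i → mkℚᵘ i (s + q * suc s)) (sym (ℤ.pos-* p r))))
              (ℚᵘ.≃-sym (ℚ.toℚᵘ-fromℚᵘ (mkℚᵘ (+ (p * r)) (s + q * suc s)))))))

/-^ : ∀ p q .{{_ : NonZero q}} n → (+ p / q) ^ℚ n ≡ _/_ (+ (p ^ n)) (q ^ n) {{m^n≢0 q n}}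
/-^ p q zero    = refl
/-^ p q (suc n) = trans (cong ((+ p / q) *ℚ_) (/-^ p q n)) (/-* p q (p ^ n) (q ^ n))
  where
  instance
    q^n≢0 : NonZero (q ^ n)
    q^n≢0 = m^n≢0 q n

n/n≡1 : ∀ n .{{_ : NonZero n}} → + n / n ≡ 1ℚ
n/n≡1 (suc n) = ℚ.toℚᵘ-injective (ℚᵘ.≃-trans (ℚ.toℚᵘ-fromℚᵘ (mkℚᵘ (+ suc n) n)) (*≡*ᵘ (ℤ.*-comm (+ suc n) (+ 1))))

-- The tester

trivial : ∀ {d} → RandomizedAlgorithm d
trivial = record { seeds = 1 ; run = λ _ → output true }

-- The number of seeds must be nonzero, so the empty list needs a default. Accepting without queries
-- preserves one-sided error and nonadaptivity, and `length-samples≢0` excludes this case where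
-- soundness is at stake.
uniformly : ∀ {A : Set} {d} → List A → (A → Algorithm d) → RandomizedAlgorithm d
uniformly []         alg = trivial
uniformly L@(_ ∷ _) alg = record { seeds = length L ; run = alg ∘ List.lookup L }

uniformly-runs : ∀ {A : Set} {d} (P : Algorithm d → Set) (L : List A) alg →
  P (output true) → (∀ a → P (alg a)) → ∀ r → P (run (uniformly L alg) r)
uniformly-runs P []      alg Pt Pa r = Pt
uniformly-runs P L@(_ ∷ _) alg Pt Pa r = Pa (List.lookup L r)

∑-lookup : ∀ {A : Set} (L : List A) g → ∑[ r ∈ allFin (length L) ] g (List.lookup L r) ≡ ∑ L g
∑-lookup L g = trans (sym (∑-map (List.lookup L) (allFin (length L)) g))
  (cong (λ M → ∑ M g) (trans (map-tabulate id (List.lookup L)) (tabulate-lookup L)))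

-- Probabilities as counts of seeds

module _ {d t : ℕ} (S : Strategy d t) (f : Input d) where

  Pr≡1 : ∀ (A : RandomizedAlgorithm d) → (∀ r → outcome S f (run A r) ≡ true) →
         Pr[ A on f against S outputs true ] ≡ 1ℚ
  Pr≡1 A accepts = trans (cong (λ n → + n / seeds A) (begin
    length (filter (λ r → outcome S f (run A r) Bool.≟ true) (allFin (seeds A)))  ≡⟨ length-filter≡∑ _ (allFin (seeds A)) ⟩
    ∑[ r ∈ allFin (seeds A) ] bit (does (outcome S f (run A r) Bool.≟ true))      ≡⟨ ∑-cong (allFin (seeds A)) (λ r → cong (λ b → bit (does (b Bool.≟ true))) (accepts r)) ⟩
    ∑[ r ∈ allFin (seeds A) ] 1                                                   ≡⟨ trans (∑-allFin-const (seeds A) 1) (*-identityʳ _) ⟩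
    seeds A                                                                       ∎)) (n/n≡1 (seeds A))
    where open ≡-Reasoning

  acceptances rejections : RandomizedAlgorithm d → ℕ
  acceptances A = ∑[ r ∈ allFin (seeds A) ] bit (does (outcome S f (run A r) Bool.≟ true))
  rejections  A = ∑[ r ∈ allFin (seeds A) ] bit (does (outcome S f (run A r) Bool.≟ false))

  acceptances+rejections : ∀ A → acceptances A + rejections A ≡ seeds A
  acceptances+rejections A = begin
    acceptances A + rejections A
      ≡⟨ ∑-distrib-+ (allFin (seeds A)) (λ r → bit (does (outcome S f (run A r) Bool.≟ true))) _ ⟨
    ∑[ r ∈ allFin (seeds A) ] (bit (does (outcome S f (run A r) Bool.≟ true)) + bit (does (outcome S f (run A r) Bool.≟ false)))
      ≡⟨ ∑-cong (allFin (seeds A)) (λ r → either (outcome S f (run A r))) ⟩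
    ∑[ r ∈ allFin (seeds A) ] 1
      ≡⟨ trans (∑-allFin-const (seeds A) 1) (*-identityʳ _) ⟩
    seeds A ∎
    where
    open ≡-Reasoning
    either : ∀ b → bit (does (b Bool.≟ true)) + bit (does (b Bool.≟ false)) ≡ 1
    either true  = refl
    either false = refl

  Pr-false≥2/3 : ∀ A → 3 * acceptances A ≤ seeds A → + 2 / 3 ≤ℚ Pr[ A on f against S outputs false ]
  Pr-false≥2/3 A few = subst (λ n → + 2 / 3 ≤ℚ + n / seeds A) (sym (length-filter≡∑ _ (allFin (seeds A))))
    (/-mono-≤ 2 3 (rejections A) (seeds A) (begin
      2 * seeds A                             ≤⟨ +-cancelˡ-≤ (3 * acceptances A) _ _ (begin
        3 * acceptances A + 2 * seeds A          ≤⟨ +-monoˡ-≤ (2 * seeds A) few ⟩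
        3 * seeds A                              ≡⟨ cong (3 *_) (acceptances+rejections A) ⟨
        3 * (acceptances A + rejections A)       ≡⟨ *-distribˡ-+ 3 (acceptances A) (rejections A) ⟩
        3 * acceptances A + 3 * rejections A     ∎) ⟩
      3 * rejections A                        ≡⟨ *-comm 3 (rejections A) ⟩
      rejections A * 3                        ∎))
    where open ≤-Reasoning

  uniformly-rejects : ∀ {A : Set} (L : List A) alg → .{{NonZero (length L)}} →
    3 * (∑[ a ∈ L ] bit (does (outcome S f (alg a) Bool.≟ true))) ≤ length L →
    + 2 / 3 ≤ℚ Pr[ uniformly L alg on f against S outputs false ]
  uniformly-rejects L@(_ ∷ _) alg few = Pr-false≥2/3 (uniformly L alg)
    (subst (λ n → 3 * n ≤ length L) (sym (∑-lookup L (λ a → bit (does (outcome S f (alg a) Bool.≟ true))))) few)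

-- The parameter u stands for ⌊1/ε⌋.
rounds : ℕ → ℕ
rounds u = 24 * u

reserve : ℕ → ℕ → ℕ
reserve t u = 36 * (t * rounds u)

samples : ∀ d m k → List ((Vec (Point d) m × Vec (Point d) m) × Vec (Fin m × Fin m) k)
samples d m k = cartesianProduct (Reserve.XY d m) (vecs (pairs m) k)

runSample : ∀ {d m k} → (Vec (Point d) m × Vec (Point d) m) × Vec (Fin m × Fin m) k → Algorithm d
runSample ((x , y) , w) = test x y w

linearityTester : ℕ → ℕ → ∀ d → RandomizedAlgorithm d
linearityTester t u d = uniformly (samples d (reserve t u) (rounds u)) runSample

length-samples : ∀ d m k → length (samples d m k) ≡ (m * m) ^ k * Reserve.T d m
length-samples d m k = begin
  length (samples d m k)                        ≡⟨ length≡∑1 (samples d m k) ⟩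
  ∑[ _ ∈ samples d m k ] 1                      ≡⟨ ∑-product (Reserve.XY d m) (vecs (pairs m) k) _ ⟩
  ∑[ _ ∈ Reserve.XY d m ] ∑[ _ ∈ vecs (pairs m) k ] 1 ≡⟨ ∑-const (Reserve.XY d m) _ ⟩
  Reserve.T d m * (∑[ _ ∈ vecs (pairs m) k ] 1) ≡⟨ cong (Reserve.T d m *_) (length≡∑1 (vecs (pairs m) k)) ⟨
  Reserve.T d m * length (vecs (pairs m) k)     ≡⟨ cong (Reserve.T d m *_) (trans (length-vecs (pairs m) k) (cong (_^ k) (length-pairs m))) ⟩
  Reserve.T d m * (m * m) ^ k                   ≡⟨ *-comm (Reserve.T d m) _ ⟩
  (m * m) ^ k * Reserve.T d m                   ∎
  where open ≡-Reasoning

^-distribʳ-* : ∀ n a b → (a * b) ^ n ≡ a ^ n * b ^ n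
^-distribʳ-* zero    a b = refl
^-distribʳ-* (suc n) a b = trans (cong (a * b *_) (^-distribʳ-* n a b)) (lemma a b (a ^ n) (b ^ n))
  where
  lemma : ∀ a b p q → a * b * (p * q) ≡ a * p * (b * q)
  lemma = solve-∀

-- The hypothesis is t⁴ ≤ (ε/K)⁴·n with ε = a/b cleared of denominators; its factors of 1 are what
-- fraction arithmetic produces. Since u ≤ b/a, the bound on t/ε passes to t·u.
threshold⇒dense : ∀ K t a b u n .{{_ : NonZero a}} → u * a ≤ b →
  t ^ 4 * ((K * b) ^ 4 * 1) ≤ (1 * a) ^ 4 * n * 1 ^ 4 → (K * (t * u)) ^ 4 ≤ n
threshold⇒dense K t a b u n ua≤b le = *-cancelˡ-≤ (a ^ 4) {{m^n≢0 a 4}} (begin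
  a ^ 4 * (K * (t * u)) ^ 4       ≡⟨ ^-distribʳ-* 4 a (K * (t * u)) ⟨
  (a * (K * (t * u))) ^ 4         ≡⟨ cong (_^ 4) (lemma a K t u) ⟩
  (t * (K * (u * a))) ^ 4         ≤⟨ ^-monoˡ-≤ 4 (*-monoʳ-≤ t (*-monoʳ-≤ K ua≤b)) ⟩
  (t * (K * b)) ^ 4               ≡⟨ ^-distribʳ-* 4 t (K * b) ⟩
  t ^ 4 * (K * b) ^ 4             ≡⟨ cong (t ^ 4 *_) (*-identityʳ ((K * b) ^ 4)) ⟨
  t ^ 4 * ((K * b) ^ 4 * 1)       ≤⟨ le ⟩
  (1 * a) ^ 4 * n * 1             ≡⟨ *-identityʳ _ ⟩
  (1 * a) ^ 4 * n                 ≡⟨ cong (λ c → c ^ 4 * n) (*-identityˡ a) ⟩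
  a ^ 4 * n                       ∎)
  where
  open ≤-Reasoning
  lemma : ∀ a K t u → a * (K * (t * u)) ≡ t * (K * (u * a))
  lemma = solve-∀

≤·2^[/4]⇒≤ : ∀ K t a b d .{{_ : NonZero K}} .{{_ : NonZero b}} → t ≤ (+ 1 / K) *ℚ (+ a / b) ·2^[ d /4] →
  t ^ 4 * ((K * b) ^ 4 * 1) ≤ (1 * a) ^ 4 * 2 ^ d * 1 ^ 4
≤·2^[/4]⇒≤ K t a b d le = /-cancel-≤ (t ^ 4) (1 ^ 4) ((1 * a) ^ 4 * 2 ^ d) ((K * b) ^ 4 * 1)
  (subst₂ _≤ℚ_ (/-^ t 1 4)
    (trans (cong (λ q → q ^ℚ 4 *ℚ fromℕ (2 ^ d)) (/-* 1 K a b))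
      (trans (cong (_*ℚ fromℕ (2 ^ d)) (/-^ (1 * a) (K * b) 4)) (/-* ((1 * a) ^ 4) ((K * b) ^ 4) (2 ^ d) 1))) le)
  where
  instance
    Kb≢0 : NonZero (K * b)
    Kb≢0 = m*n≢0 K b
    Kb⁴≢0 : NonZero ((K * b) ^ 4)
    Kb⁴≢0 = m^n≢0 (K * b) 4
    Kb⁴1≢0 : NonZero ((K * b) ^ 4 * 1)
    Kb⁴1≢0 = m*n≢0 ((K * b) ^ 4) 1

far⇒disagreement : ∀ {d} (f : Input d) a b .{{_ : NonZero b}} → ((+ a / b) -farFrom Linear) f →
  ∀ S → a * 2 ^ d ≤ b * (∑[ x ∈ points d ] bit (dot S x xor f x))
far⇒disagreement {d} f a b far S = begin
  a * 2 ^ d                                                      ≤⟨ /-cancel-≤ a b D (2 ^ d) (far (dot S) (dot-linear S)) ⟩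
  D * b                                                          ≡⟨ *-comm D b ⟩
  b * D                                                          ≡⟨ cong (b *_) (length-filter≡∑ _ (points d)) ⟩
  b * (∑[ x ∈ points d ] bit (not (does (f x Bool.≟ dot S x))))  ≡⟨ cong (b *_) (∑-cong (points d) λ x → cong bit (≢≡xor (f x) (dot S x))) ⟩
  b * (∑[ x ∈ points d ] bit (dot S x xor f x))                  ∎
  where
  open ≤-Reasoning
  instance
    2^d≢0 : NonZero (2 ^ d)
    2^d≢0 = m^n≢0 2 d
  D = length (filter (λ x → ¬? (f x Bool.≟ dot S x)) (points d))
  ≢≡xor : ∀ p q → not (does (p Bool.≟ q)) ≡ q xor p
  ≢≡xor false false = refl
  ≢≡xor false true  = refl
  ≢≡xor true  false = refl
  ≢≡xor true  true  = refl

module _ (d t a b : ℕ) {{_ : NonZero t}} {{_ : NonZero a}} {{_ : NonZero b}} (a≤b : a ≤ b) where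

  private
    u = b /ⁿ a
    K = rounds u
    M = reserve t u
    𝒜 = linearityTester t u d
    ε = + a / b

  ua≤b : u * a ≤ b
  ua≤b = m/n*n≤m b a

  instance
    u≢0 : NonZero u
    u≢0 = >-nonZero (m≥n⇒m/n>0 a≤b)

  -- Rounding 1/ε down to `u` loses at most a factor of 2, because the remainder is below `a` and
  -- `u` is at least 1. This is the factor 2 in the density 1/(2u) of violated pairs.
  b≤2ua : b ≤ 2 * u * a
  b≤2ua = begin
    b                   ≡⟨ m≡m%n+[m/n]*n b a ⟩
    b % a + u * a ≤⟨ +-monoˡ-≤ (u * a) (≤-trans (<⇒≤ (m%n<n b a)) (m≤n*m a u)) ⟩
    u * a + u * a       ≡⟨ lemma u a ⟩
    2 * u * a           ∎
    where
    open ≤-Reasoning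
    lemma : ∀ u a → u * a + u * a ≡ 2 * u * a
    lemma = solve-∀

  tester-oneSided : OneSidedError t Linear 𝒜
  tester-oneSided S f lin = Pr≡1 S f 𝒜 (uniformly-runs (λ B → outcome S f B ≡ true) (samples d M K) runSample refl
    λ ((x , y) , w) → test-accepts-linear S f lin x y w)

  tester-nonadaptive : Nonadaptive 𝒜
  tester-nonadaptive = uniformly-runs (λ B → ∃[ xs ] HasQueries xs B) (samples d M K) runSample ([] , done)
    λ ((x , y) , w) → _ , test-queries x y w

  -- 1752 = 2 · 36 · 24 + 24: two reserves of 36·24·t·u points and 24·u sums, the latter charged to
  -- t·u because t is at least 1.
  tester-numQueries : ∀ r → numQueries (run 𝒜 r) ≤ 1752 * (t * u)
  tester-numQueries = uniformly-runs (λ B → numQueries B ≤ 1752 * (t * u)) (samples d M K) runSample z≤n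
    λ ((x , y) , w) → begin
      numQueries (test x y w)                                    ≡⟨ numQueries-test x y w ⟩
      36 * (t * (24 * u)) + (36 * (t * (24 * u)) + 24 * u)       ≤⟨ +-monoʳ-≤ (36 * (t * (24 * u))) (+-monoʳ-≤ (36 * (t * (24 * u))) (*-monoʳ-≤ 24 (m≤n*m u t))) ⟩
      36 * (t * (24 * u)) + (36 * (t * (24 * u)) + 24 * (t * u)) ≡⟨ lemma t u ⟩
      1752 * (t * u)                                             ∎
    where
    open ≤-Reasoning
    lemma : ∀ t u → 36 * (t * (24 * u)) + (36 * (t * (24 * u)) + 24 * (t * u)) ≡ 1752 * (t * u)
    lemma = solve-∀

  tester-queryComplexity : ∀ r → fromℕ (numQueries (run 𝒜 r)) *ℚ ε ≤ℚ fromℕ 1752 *ℚ fromℕ t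
  tester-queryComplexity r = subst₂ _≤ℚ_ (sym (/-* q 1 a b)) (sym (/-* 1752 1 t 1))
    (/-mono-≤ (q * a) (1 * b) (1752 * t) (1 * 1) {{m*n≢0 1 b}} (begin
      q * a * (1 * 1)           ≡⟨ *-identityʳ (q * a) ⟩
      q * a                     ≤⟨ *-monoˡ-≤ a (tester-numQueries r) ⟩
      1752 * (t * u) * a        ≡⟨ lemma 1752 t u a ⟩
      1752 * t * (u * a)        ≤⟨ *-monoʳ-≤ (1752 * t) ua≤b ⟩
      1752 * t * b              ≡⟨ cong (1752 * t *_) (*-identityˡ b) ⟨
      1752 * t * (1 * b)        ∎))
    where
    open ≤-Reasoning
    q = numQueries (run 𝒜 r)
    lemma : ∀ K t u a → K * (t * u) * a ≡ K * t * (u * a)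
    lemma = solve-∀

  -- The constant 1728 is 2 · 36 · 24, so that 1728·t·u = 2M and the fourth power is 16·M⁴; the 16
  -- is the margin that bounds the expected collisions by 1/16.
  dense : t ≤ (+ 1 / 1728) *ℚ ε ·2^[ d /4] → 16 * (M * M * (M * M)) ≤ 2 ^ d
  dense t≤ = subst (_≤ 2 ^ d) 2m⁴
    (threshold⇒dense 1728 t a b u (2 ^ d) ua≤b (≤·2^[/4]⇒≤ 1728 t a b d t≤))
    where
    lemma₁ : ∀ t u → 1728 * (t * u) ≡ 2 * (36 * (t * (24 * u)))
    lemma₁ = solve-∀
    lemma₂ : ∀ m → 2 * m * (2 * m * (2 * m * (2 * m * 1))) ≡ 16 * (m * m * (m * m))
    lemma₂ = solve-∀
    2m⁴ : (1728 * (t * u)) ^ 4 ≡ 16 * (M * M * (M * M))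
    2m⁴ = trans (cong (_^ 4) (lemma₁ t u)) (lemma₂ M)

  far⇒violations : ∀ f → (ε -farFrom Linear) f → 2 ^ d * 2 ^ d ≤ 2 * u * (∑[ x ∈ points d ] ∑[ y ∈ points d ] bit (violation f x y))
  far⇒violations f far = *-cancelˡ-≤ a (begin
    a * (2 ^ d * 2 ^ d)     ≤⟨ blr-soundness f a b (far⇒disagreement f a b far) ⟩
    b * v                   ≤⟨ *-monoˡ-≤ v b≤2ua ⟩
    2 * u * a * v           ≡⟨ lemma u a v ⟩
    a * (2 * u * v)         ∎)
    where
    open ≤-Reasoning
    v = ∑[ x ∈ points d ] ∑[ y ∈ points d ] bit (violation f x y)
    lemma : ∀ u a v → 2 * u * a * v ≡ a * (2 * u * v)
    lemma = solve-∀

  length-samples≢0 : NonZero (length (samples d M K))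
  length-samples≢0 = subst NonZero (sym (trans (length-samples d M K) (cong ((M * M) ^ K *_) (Reserve.T≡ d M))))
    (m*n≢0 _ _ {{m^n≢0 (M * M) K {{m*n≢0 M M}}}} {{m*n≢0 _ _ {{N^m≢0}} {{N^m≢0}}}})
    where
    instance
      m≢0′ : NonZero M
      m≢0′ = m*n≢0 36 (t * K) {{_}} {{m*n≢0 t K {{it}} {{m*n≢0 24 u}}}}
    N^m≢0 : NonZero (length (points d) ^ M)
    N^m≢0 = m^n≢0 (length (points d)) M {{subst NonZero (sym (length-points d)) (m^n≢0 2 d)}}

  tester-resilient : t ≤ (+ 1 / 1728) *ℚ ε ·2^[ d /4] → OnlineErasureResilientTester t ε Linear 𝒜
  tester-resilient t≤ S f =
      (λ lin → subst (+ 2 / 3 ≤ℚ_) (sym (tester-oneSided S f lin)) (*≤* (+≤+ (s≤s (s≤s z≤n)))))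
    , λ far → uniformly-rejects S f (samples d M K) runSample {{length-samples≢0}}
        (subst₂ _≤_ (cong (3 *_) (sym (∑-product (Reserve.XY d M) (vecs (pairs M) K) _))) (sym (length-samples d M K))
          (acceptance-bound u S f (dense t≤) (far⇒violations f far)))

-- A positive rational carries its numerator and denominator, so ⌊1/ε⌋ is their quotient as natural
-- numbers. The catch-all clause covers ε ≤ 0, which lies outside the range of the theorem.
tester : (d t : ℕ) (ε : ℚ) → RandomizedAlgorithm d
tester d t (mkℚ (+ suc a) b-1 _) = linearityTester t (suc b-1 /ⁿ suc a) d
tester d t _                     = trivial

TesterGuarantees : (d t : ℕ) (ε : ℚ) → RandomizedAlgorithm d → Set
TesterGuarantees d t ε A =
  OneSidedError t Linear A × Nonadaptive A
  × (∀ r → fromℕ (numQueries (run A r)) *ℚ ε ≤ℚ fromℕ 1752 *ℚ fromℕ t)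
  × (t ≤ (+ 1 / 1728) *ℚ ε ·2^[ d /4] → OnlineErasureResilientTester t ε Linear A)

tester-guarantees : ∀ d t ε → 1 ≤ t → 0ℚ <ℚ ε → ε <ℚ 1ℚ → TesterGuarantees d t ε (tester d t ε)
tester-guarantees d t (mkℚ (+ 0) _ _)                (s≤s _) (*<* (+<+ ())) _
tester-guarantees d (suc t) ε@(mkℚ (+ suc a) b-1 _) (s≤s _) _ ε<1 =
  -- The guarantees are proved for the normalising fraction `+ a / b`, whereas `tester` matches on
  -- the constructor form of `ε`.
  subst (λ q → TesterGuarantees d (suc t) q (tester d (suc t) ε)) ε≡
    ( tester-oneSided d (suc t) (suc a) (suc b-1) a≤b
    , tester-nonadaptive d (suc t) (suc a) (suc b-1) a≤b
    , tester-queryComplexity d (suc t) (suc a) (suc b-1) a≤b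
    , tester-resilient d (suc t) (suc a) (suc b-1) a≤b)
  where
  ε≡ : + suc a / suc b-1 ≡ ε
  ε≡ = ℚ.↥p/↧p≡p ε
  a≤b : suc a ≤ suc b-1
  a≤b = subst₂ _≤_ (*-identityʳ (suc a)) (*-identityˡ (suc b-1))
    (/-cancel-≤ (suc a) (suc b-1) 1 1 (ℚ.<⇒≤ (subst (_<ℚ 1ℚ) (sym ε≡) ε<1)))

theoremB1 : Σ[ c₀ ∈ ℚ ] (0ℚ <ℚ c₀ × c₀ <ℚ 1ℚ ×
    (Σ[ C ∈ ℚ ] Σ[ tester ∈ ((d t : ℕ) (ε : ℚ) → RandomizedAlgorithm d) ]
    ((d t : ℕ) (ε : ℚ) → 1 ≤ t → 0ℚ <ℚ ε → ε <ℚ 1ℚ →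
    OneSidedError t Linear (tester d t ε)
    × Nonadaptive (tester d t ε)
    -- number of queries ≤ C · t / ε
    × (∀ r → fromℕ (numQueries (run (tester d t ε) r)) *ℚ ε ≤ℚ C *ℚ fromℕ t)
    × (t ≤ c₀ *ℚ ε ·2^[ d /4] → OnlineErasureResilientTester t ε Linear (tester d t ε)))))
theoremB1 = + 1 / 1728 , *<* (+<+ (s≤s z≤n)) , *<* (+<+ (s≤s (s≤s z≤n))) , fromℕ 1752 , tester , tester-guarantees
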